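{- Let $k\ge 3$ be an integer and let $d(k)=(2k+1)^{8k+4}k^2(k+1)$. Let $G$ be a graph and $c$ a vertex of $G$. Let $X\subseteq V(G)\setminus\{c\}$ be any set of vertices such that $G$ contains no edge cut of size less than $k$ separating $c$ from a vertex in $X$. If a graph $F$ of maximum degree at most $k$ does not appear in $G$ as a strong immersion, then there exist sets $Y\subseteq X$ and $K\subseteq E(G)$ such that $k|Y|+|K|<d(k)|V(F)|$ and the component of $G-Y-K$ that contains $c$ does not contain any vertex of $X$.
   Context: Graphs are finite and may have parallel edges and loops; each loop contributes $2$ to the degree of its vertex. $G-Y-K$ is the graph obtained from $G$ by removing the vertices in $Y$ (with all incident edges) and the edges in $K$. An immersion of a graph $H$ in a graph $G$ is a function $\theta$ on the vertices and edges of $H$ such that: (a) $\theta(v)$ is a vertex of $G$ for each $v\in V(H)$, and $\theta$ restricted to $V(H)$ is injective; (b) $\theta(e)$ is a connected subgraph of $G$ for each $e\in E(H)$, and for distinct $e,f\in E(H)$ the subgraphs $\theta(e)$ and $\theta(f)$ are edge-disjoint; (c) if $e\in E(H)$ is incident with $v\in V(H)$, then $\theta(v)$ is a vertex of $\theta(e)$, and if $e$ is a loop, then $\theta(e)$ contains a cycle passing through $\theta(v)$. The immersion is strong if, in addition, whenever $e\in E(H)$ is not incident with $v\in V(H)$, $\theta(e)$ does not contain $\theta(v)$. "$F$ appears in $G$ as a strong immersion" means that there is a strong immersion of $F$ in $G$. -}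

module Defs where

open import Data.Bool.Base using (_xor_)
open import Data.Fin.Base using (Fin)
open import Data.Fin.Properties using (_≟_)
open import Data.Fin.Subset using (Subset; _∈_; _∉_; _∩_; ∁; Empty; Nonempty; ∣_∣)
open import Data.Fin.Subset.Properties using (_∈?_)
open import Data.List.Base using (List; []; _∷_; length)
open import Data.List.Relation.Unary.Unique.Propositional using (Unique)
open import Data.Nat.Base using (ℕ; _+_; _*_; _^_; _≤_; _<_)
open import Data.Product.Base using (_×_; _,_; proj₁; proj₂; ∃-syntax)
open import Data.Sum.Base using (_⊎_)
open import Data.Vec.Base using (tabulate; lookup)
open import Data.Vec.Properties using (lookup∘tabulate; []=⇒lookup)
open import Function.Definitions using (Injective)
open import Relation.Binary.PropositionalEquality using (_≡_; _≢_; trans; sym)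
open import Relation.Nullary using (¬_; does; yes; _×-dec_)
open import Relation.Unary using (Pred; Decidable)
open import Level using (0ℓ)

⟪_⟫ : ∀ {n} {P : Pred (Fin n) 0ℓ} → Decidable P → Subset n
⟪ P? ⟫ = tabulate (λ i → does (P? i))

∈⟪⟫⁻ : ∀ {n} {P : Pred (Fin n) 0ℓ} (P? : Decidable P) {i} → i ∈ ⟪ P? ⟫ → P i
∈⟪⟫⁻ P? {i} i∈ with P? i | trans (sym (lookup∘tabulate (λ j → does (P? j)) i)) ([]=⇒lookup i∈)
... | yes p | _ = p

-- Finite undirected multigraphs with loops.  The order of the two ends of an
-- edge carries no meaning; a loop is an edge whose two ends coincide.

record Graph : Set where
  field
    #V   : ℕ
    #E   : ℕ
    ends : Fin #E → Fin #V × Fin #V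

  V E : Set
  V = Fin #V
  E = Fin #E

  end₁ end₂ : E → V
  end₁ e = proj₁ (ends e)
  end₂ e = proj₂ (ends e)

  Incident : E → V → Set
  Incident e v = end₁ e ≡ v ⊎ end₂ e ≡ v

  IsLoop : E → Set
  IsLoop e = end₁ e ≡ end₂ e

  Joins : E → V → V → Set
  Joins e u v = ends e ≡ (u , v) ⊎ ends e ≡ (v , u)

  -- A loop at v is counted by both summands.
  degree : V → ℕ
  degree v = ∣ ⟪ (λ e → end₁ e ≟ v) ⟫ ∣ + ∣ ⟪ (λ e → end₂ e ≟ v) ⟫ ∣

  -- The edge cut determined by A: the edges with exactly one end in A.
  δ : Subset #V → Subset #E
  δ A = tabulate (λ e → lookup A (end₁ e) xor lookup A (end₂ e))

  -- δ A ≡ δ (∁ A), so it is no restriction to put u on the side A.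
  CutSeparates : Subset #V → V → V → Set
  CutSeparates A u v = u ∈ A × v ∉ A

open Graph public

MaxDegree≤ : Graph → ℕ → Set
MaxDegree≤ G k = ∀ (v : V G) → degree G v ≤ k

record Subgraph (G : Graph) : Set where
  field
    vertices : Subset (#V G)
    edges    : Subset (#E G)
    closed   : ∀ {e} → e ∈ edges → end₁ G e ∈ vertices × end₂ G e ∈ vertices

open Subgraph public

-- G − Y − K: edges incident with Y are removed along with Y.

delete : (G : Graph) → Subset (#V G) → Subset (#E G) → Subgraph G
delete G Y K = record
  { vertices = ∁ Y
  ; edges    = ⟪ keep? ⟫
  ; closed   = λ e∈ → proj₂ (∈⟪⟫⁻ keep? e∈)
  }
  where
  keep? : Decidable (λ e → e ∈ ∁ K × (end₁ G e ∈ ∁ Y × end₂ G e ∈ ∁ Y))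
  keep? e = (e ∈? ∁ K) ×-dec ((end₁ G e ∈? ∁ Y) ×-dec (end₂ G e ∈? ∁ Y))

module _ {G : Graph} where

  data Walk (H : Subgraph G) : V G → V G → Set where
    stop : ∀ {u} → u ∈ vertices H → Walk H u u
    step : ∀ {u v w} (e : E G) → e ∈ edges H → Joins G e u v →
           Walk H v w → Walk H u w

  module _ {H : Subgraph G} where

    -- The vertices of a walk, in order, except for its final one.
    walkVertices : ∀ {u v} → Walk H u v → List (V G)
    walkVertices (stop _)               = []
    walkVertices (step {u = u} _ _ _ W) = u ∷ walkVertices W

    walkEdges : ∀ {u v} → Walk H u v → List (E G)
    walkEdges (stop _)       = []
    walkEdges (step e _ _ W) = e ∷ walkEdges W

    -- Cycles of length 1 (a loop) and 2 (two parallel edges) are allowed; edge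
    -- distinctness excludes going back and forth along a single edge.
    IsCycle : ∀ {u} → Walk H u u → Set
    IsCycle W = 1 ≤ length (walkEdges W) × Unique (walkVertices W) × Unique (walkEdges W)

  Connected : Subgraph G → Set
  Connected H = Nonempty (vertices H) ×
                (∀ {u v} → u ∈ vertices H → v ∈ vertices H → Walk H u v)

  -- The vertex set of the component of H that contains c.
  Component : Subgraph G → V G → Pred (V G) 0ℓ
  Component H c v = Walk H c v

  -- A cycle through v can be traversed starting from v.
  HasCycleThrough : Subgraph G → V G → Set
  HasCycleThrough H v = ∃[ W ] IsCycle {H = H} {u = v} W

  EdgeDisjoint : Subgraph G → Subgraph G → Set
  EdgeDisjoint H H′ = Empty (edges H ∩ edges H′)

record Immersion (F G : Graph) : Set where
  field
    θV            : V F → V G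
    θE            : E F → Subgraph G
    injective     : Injective _≡_ _≡_ θV
    connected     : ∀ e → Connected (θE e)
    edge-disjoint : ∀ {e f} → e ≢ f → EdgeDisjoint (θE e) (θE f)
    incident      : ∀ {e v} → Incident F e v → θV v ∈ vertices (θE e)
    loop          : ∀ {e v} → Incident F e v → IsLoop F e → HasCycleThrough (θE e) (θV v)

record StrongImmersion (F G : Graph) : Set where
  field
    immersion : Immersion F G
  open Immersion immersion public
  field
    strong : ∀ {e v} → ¬ Incident F e v → θV v ∉ vertices (θE e)

d : ℕ → ℕ
d k = (2 * k + 1) ^ (8 * k + 4) * k ^ 2 * (k + 1)

{-# OPTIONS --safe #-}

-- Everything is expressed by edge cuts: a demand on the vertices can be routed to c along
-- edge-disjoint walks as soon as no set violates the cut condition, because the cut function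
-- is submodular.  A maximal demand on X, at most k per vertex and with no transit through X,
-- is blocked by a tight set R; either Y = X ∖ R and the edges from R to vertices outside R ∪ X
-- give a cheap separation, or many terminals S ⊆ X can each send one unit to c without transit through S.
--
-- In the second case the connectivity of S is first supported by an edge set M having at most
-- 2k|S| ends in S: for M minimal, each edge lies in a tight cut, and uncrossing charges the
-- edges at terminals to a tree of tight sets.  Half of the terminals have M-degree at most 4k.
-- Among these let T be maximal such that every t ∈ T can send k units to c without transit
-- through T.  Giving up at most k|T| terminals, the rest (A) may still send one unit each on
-- top of this, so a set U with slack g(U) contains at most g(U) elements of A.  By maximality
-- every x ∈ A lies in a set of slack below k.  In k rounds a closed set U absorbs all of these:
-- in each round disjoint sets are added, each paid for by a vertex of T, or by an edge from U or
-- an M-edge from T entering it, and the sets that were not added lose one unit of slack.  Hence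
-- |A| is at most k^k (5k + 1)|T|, so |T| ≥ |V(F)|, and F is immersed by sending both halves of
-- each edge of F to c.

module Submission where

open import Defs
open import Data.Bool.Base using (Bool; true; false; not; _∧_; _∨_; _xor_; if_then_else_)
import Data.Bool.Properties as 𝔹
open import Data.Empty using (⊥; ⊥-elim)
open import Data.Fin.Base using (Fin; zero; suc)
open import Data.Fin.Properties using (any?; all?) renaming (_≟_ to _≟ᶠ_)
open import Data.Fin.Subset using (Subset; _∈_; _∉_; _⊆_; ∣_∣; ∁)
open import Data.Fin.Subset.Properties using (anySubset?)
open import Data.List.Base using (List; []; _∷_; _++_)
open import Data.Nat.Base using (ℕ; zero; suc; _+_; _*_; _^_; _∸_; _≤_; _<_; z≤n; s≤s)
open import Data.Nat.Properties renaming (_≟_ to _≟ⁿ_)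
open import Data.Nat.Tactic.RingSolver using (solve; solve-∀)
open import Data.Product.Base using (Σ; _×_; _,_; proj₁; proj₂; ∃; ∃-syntax)
open import Data.Sum.Base using (_⊎_; inj₁; inj₂; [_,_]′)
open import Data.Vec.Base using (tabulate; lookup)
open import Data.Vec.Properties using (lookup∘tabulate; []=⇒lookup; lookup⇒[]=)
open import Function.Base using (_∘_; case_of_)
open import Relation.Binary.PropositionalEquality
open import Relation.Nullary using (¬_; Dec; yes; no; does; map′; ¬?; _×-dec_; _⊎-dec_; _→-dec_)
open import Relation.Nullary.Decidable using (toWitness)
open import Algebra.Properties.CommutativeMonoid.Sum +-0-commutativeMonoid
  using (sum; sum-cong-≗; ∑-distrib-+; ∑-comm)
open import Data.Fin.Subset.Properties using (x∈p∩q⁻; x∈∁p⇒x∉p; _∈?_)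
open import Data.List.Membership.Propositional using () renaming (_∈_ to _∈ˡ_)
open import Data.List.Membership.Propositional.Properties using (∈-++⁺ˡ; ∈-++⁺ʳ; ∈-++⁻)
import Data.List.Membership.DecPropositional as DecMembership
open import Data.List.Relation.Binary.Disjoint.Propositional using (Disjoint)
import Data.List.Relation.Unary.All as All
open import Data.List.Relation.Unary.Any using (here; there)
open import Data.List.Relation.Unary.Unique.Propositional using (Unique)
import Data.List.Relation.Unary.Unique.Propositional.Properties as Unique

-- A strong immersion forbids transit through branch vertices, so arcs entering `T` are unusable,
-- and edges from a set to `T` do not count as exits of it. As a terminal may have unbounded degree,
-- the connectivity of a vertex to `c` could consist of such edges. This is the purpose of `M`: it
-- keeps every terminal `k`-connected to `c`, while the selected terminals have few ends of `M`
-- among them, so only boundedly many disjoint sets can owe their connectivity to edges at `T`. The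
-- slack of a set is its number of exits in `avoid T` minus `k` for each of its vertices in `T`; it
-- is submodular. A set that is not added in a round overlaps the new closed set outside the old
-- one, `U`. As `U` is closed, the overlap together with `U` has more slack than `U`, and
-- submodularity turns this into one unit saved. After `k` rounds, uniting with such a set would
-- lower the slack, which closedness excludes. A round adds at most `g U + q` sets, at a price of at
-- most `k - 1` each, so it multiplies `g U + q` by at most `k`: this is the factor `k ^ k`.

all𝔹 : {P : Bool → Set} → (∀ b → Dec (P b)) → Dec (∀ b → P b)
all𝔹 P? = map′ (λ { (p , q) true → p ; (p , q) false → q }) (λ f → f true , f false)
  (P? true ×-dec P? false)

-- Booleans as numbers, and finite sums.

b2n : Bool → ℕ
b2n true  = 1
b2n false = 0

contra : {b : Bool} {A : Set} → b ≡ true → b ≡ false → A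
contra refl ()

¬true : ∀ {b} → ¬ (b ≡ true) → b ≡ false
¬true {false} _ = refl
¬true {true}  h = ⊥-elim (h refl)

∨⁻ : ∀ {a b} → a ∨ b ≡ true → a ≡ true ⊎ b ≡ true
∨⁻ {true}  _ = inj₁ refl
∨⁻ {false} h = inj₂ h

∨ˡ : ∀ {a b} → a ≡ true → a ∨ b ≡ true
∨ˡ refl = refl

∨ʳ : ∀ {a b} → b ≡ true → a ∨ b ≡ true
∨ʳ {true}  _ = refl
∨ʳ {false} h = h

∧⁻ : ∀ {a b} → a ∧ b ≡ true → a ≡ true × b ≡ true
∧⁻ {true} h = refl , h

∧⁺ : ∀ {a b} → a ≡ true → b ≡ true → a ∧ b ≡ true
∧⁺ refl refl = refl

∨-false : ∀ {a b} → a ≡ false → b ≡ false → a ∨ b ≡ false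
∨-false refl refl = refl

∧-falseˡ : ∀ {a b} → a ≡ false → a ∧ b ≡ false
∧-falseˡ refl = refl

∧-falseʳ : ∀ {a b} → b ≡ false → a ∧ b ≡ false
∧-falseʳ {true}  h = h
∧-falseʳ {false} _ = refl

not⁻ : ∀ {a} → not a ≡ true → a ≡ false
not⁻ {false} _ = refl

-- A substitute for linear arithmetic: `p ≤ q` is the sum of the hypotheses, `s` is what is left
-- over, and the equation can be handed to the ring solver.
linear : ∀ {a b p q} s → p ≤ q → a + q + s ≡ b + p → a ≤ b
linear {a} {b} {p} {q} s p≤q eq = +-cancelʳ-≤ q a b (begin
  a + q      ≤⟨ m≤m+n (a + q) s ⟩
  a + q + s  ≡⟨ eq ⟩
  b + p      ≤⟨ +-monoʳ-≤ b p≤q ⟩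
  b + q      ∎)
  where open ≤-Reasoning

sum-mono : ∀ {n} {f g : Fin n → ℕ} → (∀ i → f i ≤ g i) → sum f ≤ sum g
sum-mono {zero}  h = z≤n
sum-mono {suc n} h = +-mono-≤ (h zero) (sum-mono (h ∘ suc))

sum-mono-< : ∀ {n} {f g : Fin n → ℕ} → (∀ i → f i ≤ g i) → ∀ i → f i < g i → sum f < sum g
sum-mono-< h zero    l = +-mono-<-≤ l (sum-mono (h ∘ suc))
sum-mono-< h (suc i) l = +-mono-≤-< (h zero) (sum-mono-< (h ∘ suc) i l)

term≤sum : ∀ {n} (f : Fin n → ℕ) i → f i ≤ sum f
term≤sum f zero    = m≤m+n _ _
term≤sum f (suc i) = ≤-trans (term≤sum (f ∘ suc) i) (m≤n+m _ _)

sum-zero : ∀ n → sum {n} (λ _ → 0) ≡ 0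
sum-zero zero    = refl
sum-zero (suc n) = sum-zero n

sum-*ˡ : ∀ {n} k (f : Fin n → ℕ) → sum (λ i → k * f i) ≡ k * sum f
sum-*ˡ {zero}  k f = sym (*-zeroʳ k)
sum-*ˡ {suc n} k f = trans (cong (k * f zero +_) (sum-*ˡ k (f ∘ suc))) (sym (*-distribˡ-+ k (f zero) _))

sum-<-witness : ∀ {n} {f g : Fin n → ℕ} → sum f < sum g → ∃[ i ] f i < g i
sum-<-witness {suc n} {f} {g} h with f zero <? g zero
... | yes l = zero , l
... | no ¬l =
  let i , l = sum-<-witness {n} {f ∘ suc} {g ∘ suc}
                (+-cancelˡ-< (g zero) _ _ (≤-<-trans (+-monoˡ-≤ _ (≮⇒≥ ¬l)) h))
  in suc i , l

does⇒ : ∀ {P : Set} (p? : Dec P) → does p? ≡ true → P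
does⇒ (yes p) _ = p

_==_ : ∀ {n} → Fin n → Fin n → Bool
i == j = does (i ≟ᶠ j)

==-refl : ∀ {n} (i : Fin n) → (i == i) ≡ true
==-refl i with i ≟ᶠ i
... | yes _ = refl
... | no ¬p = ⊥-elim (¬p refl)

==⇒≡ : ∀ {n} {i j : Fin n} → (i == j) ≡ true → i ≡ j
==⇒≡ {i = i} {j} h with i ≟ᶠ j
... | yes p = p

sum-δ : ∀ {n} (f : Fin n → ℕ) i → sum (λ j → if j == i then f j else 0) ≡ f i
sum-δ {suc n} f zero    = trans (cong (f zero +_) (sum-zero n)) (+-identityʳ _)
sum-δ {suc n} f (suc i) = trans (sum-cong-≗ λ j → aux j) (sum-δ (f ∘ suc) i)
  where
  aux : ∀ j → (if suc j == suc i then f (suc j) else 0) ≡ (if j == i then f (suc j) else 0)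
  aux j with j ≟ᶠ i
  ... | yes _ = refl
  ... | no  _ = refl

-- Subsets as Boolean functions, and the existence of extremal ones.

Sub : ℕ → Set
Sub n = Fin n → Bool

infix 4 _⊑_
infixr 6 _∪ᵇ_
infixr 7 _∩ᵇ_

_⊑_ : ∀ {n} → Sub n → Sub n → Set
A ⊑ B = ∀ i → A i ≡ true → B i ≡ true

_∪ᵇ_ _∩ᵇ_ _∖ᵇ_ : ∀ {n} → Sub n → Sub n → Sub n
(A ∪ᵇ B) i = A i ∨ B i
(A ∩ᵇ B) i = A i ∧ B i
(A ∖ᵇ B) i = A i ∧ not (B i)

∅ᵇ : ∀ {n} → Sub n
∅ᵇ _ = false

insert : ∀ {n} → Fin n → Sub n → Sub n
insert x A i = A i ∨ (i == x)

remove : ∀ {n} → Fin n → Sub n → Sub n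
remove x A i = A i ∧ not (i == x)

size : ∀ {n} → Sub n → ℕ
size A = sum (b2n ∘ A)

⊑-antisym : ∀ {n} {A B : Sub n} → A ⊑ B → B ⊑ A → A ≗ B
⊑-antisym {A = A} {B} p q i with A i in a | B i in b
... | true  | true  = refl
... | false | false = refl
... | true  | false = contra (p i a) b
... | false | true  = contra (q i b) a

b2n-mono : ∀ {a b} → (a ≡ true → b ≡ true) → b2n a ≤ b2n b
b2n-mono {false} _ = z≤n
b2n-mono {true}  h rewrite h refl = ≤-refl

b2n≤ : ∀ b {n} → (b ≡ true → 1 ≤ n) → b2n b ≤ n
b2n≤ true  h = h refl
b2n≤ false h = z≤n

size-mono : ∀ {n} {A B : Sub n} → A ⊑ B → size A ≤ size B
size-mono h = sum-mono (λ i → b2n-mono (h i))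

size-mono-< : ∀ {n} {A B : Sub n} → A ⊑ B → ∀ i → A i ≡ false → B i ≡ true → size A < size B
size-mono-< h i a b = sum-mono-< (λ j → b2n-mono (h j)) i
  (subst₂ (λ p q → b2n p < b2n q) (sym a) (sym b) ≤-refl)

size-cong : ∀ {n} {A B : Sub n} → A ≗ B → size A ≡ size B
size-cong h = sum-cong-≗ (cong b2n ∘ h)

size-ext : ∀ {n} (A B : Sub n) → A ⊑ B → size B ≤ size A → B ⊑ A
size-ext A B h l i b with A i in a
... | true  = refl
... | false = ⊥-elim (<⇒≱ (size-mono-< h i a b) l)

size≤ : ∀ {n} (A : Sub n) → size A ≤ n
size≤ {zero}  A = z≤n
size≤ {suc n} A with A zero
... | true  = s≤s (size≤ (A ∘ suc))
... | false = m≤n⇒m≤1+n (size≤ (A ∘ suc))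

_⊑?_ : ∀ {n} (A B : Sub n) → Dec (A ⊑ B)
A ⊑? B = map′ (λ f → f) (λ f → f) (all? (λ i → (A i 𝔹.≟ true) →-dec (B i 𝔹.≟ true)))

Extensional : ∀ {n} → (Sub n → Set) → Set
Extensional P = ∀ {A B} → A ≗ B → P A → P B

abstract
  -- The search runs over vectors while a `Sub n` is a function; in the absence of function
  -- extensionality `P` has to be transported along `≗`.
  search : ∀ {n} {P : Sub n → Set} → (∀ A → Dec (P A)) → Extensional P → Dec (∃ P)
  search P? ext = map′ (λ (v , p) → lookup v , p)
    (λ (A , p) → tabulate A , ext (λ i → sym (lookup∘tabulate A i)) p)
    (anySubset? (P? ∘ lookup))

Maximal Minimal : ∀ {n} → (Sub n → Set) → Sub n → Set
Maximal P A = P A × (∀ {B} → A ⊑ B → P B → B ⊑ A)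
Minimal P A = P A × (∀ {B} → B ⊑ A → P B → A ⊑ B)

abstract
  maximal : ∀ {n} {P : Sub n → Set} → (∀ A → Dec (P A)) → Extensional P → ∀ A → P A → ∃[ B ] (A ⊑ B × Maximal P B)
  maximal {n} {P} P? ext A p = go n A p (≤-trans (m≤m+n n _) ≤-refl)
      where
      Bigger : Sub n → Sub n → Set
      Bigger A B = P B × A ⊑ B × size A < size B
      bigger? : ∀ A → Dec (∃ (Bigger A))
      bigger? A = search (λ B → P? B ×-dec (A ⊑? B) ×-dec (size A <? size B))
        λ e (p , h , l) → ext e p , (λ i a → trans (sym (e i)) (h i a)) , subst (size A <_) (size-cong e) l
      go : ∀ m A → P A → n ≤ m + size A → ∃[ B ] (A ⊑ B × Maximal P B)
      go m A p h with bigger? A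
      ... | no ¬b = A , (λ _ a → a) , p , λ {B} A⊑B q → size-ext A B A⊑B (≮⇒≥ λ l → ¬b (B , q , A⊑B , l))
      go zero A p h | yes (B , q , A⊑B , l) = ⊥-elim (<⇒≱ l (≤-trans (size≤ B) h))
      go (suc m) A p h | yes (B , q , A⊑B , l) =
        let C , B⊑C , mx = go m B q (≤-trans h (≤-trans (≤-reflexive (sym (+-suc m (size A)))) (+-monoʳ-≤ m l)))
        in C , (λ i → B⊑C i ∘ A⊑B i) , mx

  minimal : ∀ {n} {P : Sub n → Set} → (∀ A → Dec (P A)) → Extensional P → ∀ A → P A → ∃[ B ] (B ⊑ A × Minimal P B)
  minimal {n} {P} P? ext A p =
    let B , A⊑B , q , mx = maximal {P = λ B → P (not ∘ B)} (λ B → P? (not ∘ B)) (λ e → ext (cong not ∘ e))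
                             (not ∘ A) (ext (λ i → sym (𝔹.not-involutive (A i))) p)
    in not ∘ B , flip A⊑B , q , λ {C} C⊑ r →
         flip (mx {not ∘ C} (flip′ C⊑) (ext (λ i → sym (𝔹.not-involutive (C i))) r))
    where
    flip : ∀ {A B : Sub n} → not ∘ A ⊑ B → not ∘ B ⊑ A
    flip {A} h i b with A i in a
    ... | true  = refl
    ... | false = contra (h i (cong not a)) (not⁻ b)
    flip′ : ∀ {A B : Sub n} → A ⊑ not ∘ B → B ⊑ not ∘ A
    flip′ {A} h i b with A i in a
    ... | true  = contra b (not⁻ (h i a))
    ... | false = refl

  argmax : ∀ {n} {P : Fin n → Set} → (∀ i → Dec (P i)) → (μ : Fin n → ℕ) → ∃ P →
           ∃[ i ] (P i × (∀ j → P j → μ j ≤ μ i))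
  argmax {suc n} {P} P? μ w with any? (P? ∘ suc) | P? zero
  ... | no ¬q | yes p = zero , p , λ { zero _ → ≤-refl ; (suc j) q → ⊥-elim (¬q (j , q)) }
  ... | no ¬q | no ¬p = case w of λ { (zero , p) → ⊥-elim (¬p p) ; (suc j , q) → ⊥-elim (¬q (j , q)) }
  ... | yes q | p? with argmax (P? ∘ suc) (μ ∘ suc) q | p?
  ...   | i , qi , mx | no ¬p = suc i , qi , λ { zero p → ⊥-elim (¬p p) ; (suc j) → mx j }
  ...   | i , qi , mx | yes p with μ zero ≤? μ (suc i)
  ...     | yes l = suc i , qi , λ { zero _ → l ; (suc j) → mx j }
  ...     | no ¬l = zero , p , λ { zero _ → ≤-refl ; (suc j) q → ≤-trans (mx j q) (<⇒≤ (≰⇒> ¬l)) }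

-- Demands as modular set functions.

_⇔ᵇ_ : Bool → Bool → Bool
a ⇔ᵇ b = not (a xor b)

-- `amount R` is what the vertices of `R` owe together. Modularity is the property that lets tight
-- sets be uncrossed against a submodular cut function.
record Demand (n : ℕ) : Set where
  field
    amount  : Sub n → ℕ
    ext     : ∀ {A B} → A ≗ B → amount A ≡ amount B
    mono    : ∀ {A B} → A ⊑ B → amount A ≤ amount B
    modular : ∀ A B → amount (A ∪ᵇ B) + amount (A ∩ᵇ B) ≡ amount A + amount B

open Demand public

at : ∀ {n} → Fin n → Demand n
at u .amount R      = b2n (R u)
at u .ext e         = cong b2n (e u)
at u .mono h        = b2n-mono (h u)
-- Through `all𝔹` the decision is a truth table, evaluated by `toWitness`; the pointwise
-- inequalities behind submodularity are proved in the same way.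
at u .modular A B   = toWitness {a? = all𝔹 λ a → all𝔹 λ b → b2n (a ∨ b) + b2n (a ∧ b) ≟ⁿ b2n a + b2n b} _ (A u) (B u)

0ᵈ : ∀ {n} → Demand n
0ᵈ .amount _    = 0
0ᵈ .ext _       = refl
0ᵈ .mono _      = z≤n
0ᵈ .modular _ _ = refl

+-interchange : ∀ a b c d → (a + b) + (c + d) ≡ (a + c) + (b + d)
+-interchange a b c d = solve (a ∷ b ∷ c ∷ d ∷ [])

infixl 6 _⊕_
_⊕_ : ∀ {n} → Demand n → Demand n → Demand n
(D ⊕ D′) .amount R    = amount D R + amount D′ R
(D ⊕ D′) .ext e       = cong₂ _+_ (ext D e) (ext D′ e)
(D ⊕ D′) .mono h      = +-mono-≤ (mono D h) (mono D′ h)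
(D ⊕ D′) .modular A B = begin
  (amount D (A ∪ᵇ B) + amount D′ (A ∪ᵇ B)) + (amount D (A ∩ᵇ B) + amount D′ (A ∩ᵇ B))
    ≡⟨ +-interchange (amount D (A ∪ᵇ B)) _ _ _ ⟩
  (amount D (A ∪ᵇ B) + amount D (A ∩ᵇ B)) + (amount D′ (A ∪ᵇ B) + amount D′ (A ∩ᵇ B))
    ≡⟨ cong₂ _+_ (modular D A B) (modular D′ A B) ⟩
  (amount D A + amount D B) + (amount D′ A + amount D′ B)
    ≡⟨ +-interchange (amount D A) _ _ _ ⟩
  (amount D A + amount D′ A) + (amount D B + amount D′ B) ∎
  where open ≡-Reasoning

⨁ : ∀ {n m} → (Fin m → Demand n) → Demand n
⨁ {m = zero}  D = 0ᵈ
⨁ {m = suc m} D = D zero ⊕ ⨁ (D ∘ suc)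

⨁-amount : ∀ {n m} (D : Fin m → Demand n) R → amount (⨁ D) R ≡ sum (λ i → amount (D i) R)
⨁-amount {m = zero}  D R = refl
⨁-amount {m = suc m} D R = cong (amount (D zero) R +_) (⨁-amount (D ∘ suc) R)

infix 7 _·_
_·_ : ∀ {n} → ℕ → Demand n → Demand n
(k · D) .amount R    = k * amount D R
(k · D) .ext e       = cong (k *_) (ext D e)
(k · D) .mono h      = *-monoʳ-≤ k (mono D h)
(k · D) .modular A B = trans (sym (*-distribˡ-+ k (amount D (A ∪ᵇ B)) _))
  (trans (cong (k *_) (modular D A B)) (*-distribˡ-+ k (amount D A) _))

∪∩-modular : ∀ x a b → x * b2n (a ∨ b) + x * b2n (a ∧ b) ≡ x * b2n a + x * b2n b
∪∩-modular x true  true  = refl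
∪∩-modular x true  false = refl
∪∩-modular x false true  = +-comm (x * 1) (x * 0)
∪∩-modular x false false = refl

weight : ∀ {n} → (Fin n → ℕ) → Demand n
weight b .amount R    = sum (λ v → b v * b2n (R v))
weight b .ext e       = sum-cong-≗ (λ v → cong (λ x → b v * b2n x) (e v))
weight b .mono h      = sum-mono (λ v → *-monoʳ-≤ (b v) (b2n-mono (h v)))
weight b .modular A B = trans (sym (∑-distrib-+ (λ v → b v * b2n (A v ∨ B v)) _))
  (trans (sum-cong-≗ (λ v → ∪∩-modular (b v) (A v) (B v))) (∑-distrib-+ (λ v → b v * b2n (A v)) _))

on : ∀ {n} → Sub n → Demand n
on T = weight (b2n ∘ T)

-- Arcs, exits of a set, and submodularity.

module Arcs (G : Graph) where

  src dst : E G → Bool → V G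
  src e true  = end₁ G e
  src e false = end₂ G e
  dst e b = src e (not b)

  -- A set of arcs: every edge has two opposite orientations, indexed by a Boolean.
  Arc : Set
  Arc = E G → Bool → Bool

  is : E G → Bool → Arc
  is e b e′ b′ = (e′ == e) ∧ (b′ ⇔ᵇ b)

  abstract
    ∑ₐ : (E G → Bool → ℕ) → ℕ
    ∑ₐ f = sum (λ e → f e true + f e false)

    ∑ₐ-def : ∀ f → ∑ₐ f ≡ sum (λ e → f e true + f e false)
    ∑ₐ-def f = refl

    ∑ₐ-mono : ∀ {f g} → (∀ e b → f e b ≤ g e b) → ∑ₐ f ≤ ∑ₐ g
    ∑ₐ-mono h = sum-mono (λ e → +-mono-≤ (h e true) (h e false))

    ∑ₐ-mono-< : ∀ {f g} → (∀ e b → f e b ≤ g e b) → ∀ e b → f e b < g e b → ∑ₐ f < ∑ₐ g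
    ∑ₐ-mono-< h e true  l = sum-mono-< (λ e → +-mono-≤ (h e true) (h e false)) e (+-mono-<-≤ l (h e false))
    ∑ₐ-mono-< h e false l = sum-mono-< (λ e → +-mono-≤ (h e true) (h e false)) e (+-mono-≤-< (h e true) l)

    ∑ₐ-cong : ∀ {f g} → (∀ e b → f e b ≡ g e b) → ∑ₐ f ≡ ∑ₐ g
    ∑ₐ-cong h = sum-cong-≗ (λ e → cong₂ _+_ (h e true) (h e false))

    ∑ₐ-flip : ∀ f → ∑ₐ f ≡ ∑ₐ (λ e b → f e (not b))
    ∑ₐ-flip f = sum-cong-≗ (λ e → +-comm (f e true) (f e false))

    ∑ₐ-+ : ∀ f g → ∑ₐ (λ e b → f e b + g e b) ≡ ∑ₐ f + ∑ₐ g
    ∑ₐ-+ f g = trans (sum-cong-≗ (λ e → +-interchange (f e true) (g e true) _ _))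
      (∑-distrib-+ (λ e → f e true + f e false) (λ e → g e true + g e false))

    ∑ₐ-witness : ∀ {f g} → ∑ₐ f < ∑ₐ g → ∃[ e ] ∃[ b ] f e b < g e b
    ∑ₐ-witness {f} {g} h with sum-<-witness h
    ... | e , l with f e true <? g e true
    ...   | yes l₁ = e , true , l₁
    ...   | no ¬l₁ = e , false , +-cancelˡ-< (g e true) _ _ (≤-<-trans (+-monoˡ-≤ _ (≮⇒≥ ¬l₁)) l)

    ∑ₐ-sum : ∀ {m} (f : Fin m → E G → Bool → ℕ) →
      ∑ₐ (λ e b → sum (λ i → f i e b)) ≡ sum (λ i → ∑ₐ (f i))
    ∑ₐ-sum f = trans (sum-cong-≗ λ e → sym (∑-distrib-+ (λ i → f i e true) (λ i → f i e false)))
      (∑-comm (λ e i → f i e true + f i e false))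

    ∑ₐ-δ : ∀ (f : E G → Bool → ℕ) e b → ∑ₐ (λ e′ b′ → if is e b e′ b′ then f e′ b′ else 0) ≡ f e b
    ∑ₐ-δ f e true  = trans (sum-cong-≗ λ e′ → lem (e′ == e)) (sum-δ (λ e′ → f e′ true) e)
      where
      lem : ∀ q {x y} → (if q ∧ true then x else 0) + (if q ∧ false then y else 0) ≡ (if q then x else 0)
      lem true  = +-identityʳ _
      lem false = refl
    ∑ₐ-δ f e false = trans (sum-cong-≗ λ e′ → lem (e′ == e)) (sum-δ (λ e′ → f e′ false) e)
      where
      lem : ∀ q {x y} → (if q ∧ false then x else 0) + (if q ∧ true then y else 0) ≡ (if q then y else 0)
      lem true  = refl
      lem false = refl

  crosses : Sub (#V G) → Arc
  crosses R e b = R (src e b) ∧ not (R (dst e b))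

  out : Arc → Sub (#V G) → ℕ
  out α R = ∑ₐ (λ e b → b2n (α e b ∧ crosses R e b))

  out-ext : ∀ α {A B} → A ≗ B → out α A ≡ out α B
  out-ext α {A} {B} h = ∑ₐ-cong (λ e b → cong (b2n ∘ (α e b ∧_)) (cong₂ (λ x y → x ∧ not y) (h (src e b)) (h (dst e b))))

  out-∅ : ∀ α → out α ∅ᵇ ≡ 0
  out-∅ α = trans (∑ₐ-cong λ e b → cong b2n (𝔹.∧-zeroʳ (α e b))) (trans (∑ₐ-def (λ _ _ → 0)) (sum-zero (#E G)))

  ∑ₐ-mono₂₂ : ∀ f g h k → (∀ e b → f e b + g e b ≤ h e b + k e b) → ∑ₐ f + ∑ₐ g ≤ ∑ₐ h + ∑ₐ k
  ∑ₐ-mono₂₂ f g h k l = subst₂ _≤_ (∑ₐ-+ f g) (∑ₐ-+ h k) (∑ₐ-mono l)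

  private
    joint apart : (a x y u v : Bool) → ℕ
    joint a x y u v = b2n (a ∧ (x ∨ u) ∧ not (y ∨ v)) + b2n (a ∧ (x ∧ u) ∧ not (y ∧ v))
    apart a x y u v = b2n (a ∧ x ∧ not y) + b2n (a ∧ u ∧ not v)

    submod : ∀ a x y u v → joint a x y u v ≤ apart a x y u v
    submod = toWitness {a? = all𝔹 λ a → all𝔹 λ x → all𝔹 λ y → all𝔹 λ u → all𝔹 λ v →
      joint a x y u v ≤? apart a x y u v} _

    submod-< : ∀ {a x y u v} → a ≡ true → x ∧ not y ≡ true → u ≡ false → v ≡ true →
      joint a x y u v < apart a x y u v
    submod-< {x = true} {false} refl _ refl refl = ≤-refl

  out-submod : ∀ α A B → out α (A ∪ᵇ B) + out α (A ∩ᵇ B) ≤ out α A + out α B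
  out-submod α A B = ∑ₐ-mono₂₂ _ _ _ _ (λ e b → submod (α e b) (A (src e b)) (A (dst e b)) (B (src e b)) (B (dst e b)))

  -- An arc leaving A and entering B is not counted on the left.
  out-submod-< : ∀ α A B e b → α e b ≡ true → crosses A e b ≡ true →
    B (src e b) ≡ false → B (dst e b) ≡ true →
    out α (A ∪ᵇ B) + out α (A ∩ᵇ B) < out α A + out α B
  out-submod-< α A B e b αe cA u v = subst₂ _<_ (∑ₐ-+ _ _) (∑ₐ-+ _ _)
    (∑ₐ-mono-< (λ e b → submod (α e b) (A (src e b)) (A (dst e b)) (B (src e b)) (B (dst e b))) e b
      (submod-< {x = A (src e b)} αe cA u v))

  out-mono : ∀ α β R → (∀ e b → crosses R e b ≡ true → α e b ≡ true → β e b ≡ true) → out α R ≤ out β R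
  out-mono α β R h = ∑ₐ-mono (λ e b → b2n-mono {α e b ∧ crosses R e b} λ p →
    let p₁ , p₂ = ∧⁻ {α e b} p in ∧⁺ (h e b p₂ p₁) p₂)

  kill : Arc → E G → Bool → Arc
  kill α e b e′ b′ = α e′ b′ ∧ not (is e b e′ b′)

  out-kill : ∀ α e b R → out α R ≤ out (kill α e b) R + b2n (α e b ∧ crosses R e b)
  out-kill α e b R = subst (out α R ≤_)
    (trans (∑ₐ-+ _ _) (cong (out (kill α e b) R +_) (∑ₐ-δ (λ e b → b2n (α e b ∧ crosses R e b)) e b)))
    (∑ₐ-mono (λ e′ b′ → lem (α e′ b′) (is e b e′ b′) (crosses R e′ b′)))
    where
    lem : ∀ a q x → b2n (a ∧ x) ≤ b2n ((a ∧ not q) ∧ x) + (if q then b2n (a ∧ x) else 0)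
    lem = toWitness {a? = all𝔹 λ a → all𝔹 λ q → all𝔹 λ x → _ ≤? _} _

  kill⁻ : ∀ α e b e′ b′ → kill α e b e′ b′ ≡ true → α e′ b′ ≡ true
  kill⁻ α e b e′ b′ h = proj₁ (∧⁻ {α e′ b′} h)

-- The cut condition and the rerouting of one unit.

module Flow (G : Graph) (c : V G) where

  open Arcs G public

  -- For D modular this is the cut condition for a flow in which every vertex v other than c
  -- sends amount D {v} units to c along arcs of α of unit capacity.
  Feasible : Arc → Demand (#V G) → Set
  Feasible α D = ∀ R → R c ≡ false → amount D R ≤ out α R

  Violated : Arc → Demand (#V G) → Sub (#V G) → Set
  Violated α D R = R c ≡ false × out α R < amount D R

  feasible? : ∀ α D → Feasible α D ⊎ ∃ (Violated α D)
  feasible? α D with search {P = Violated α D} (λ R → (R c 𝔹.≟ false) ×-dec (out α R <? amount D R))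
      (λ e (p , l) → trans (sym (e c)) p , subst₂ _<_ (out-ext α e) (ext D e) l)
  ... | yes v = inj₂ v
  ... | no ¬v = inj₁ λ R p → ≮⇒≥ λ l → ¬v (R , p , l)

  Tight : Arc → Demand (#V G) → Sub (#V G) → Set
  Tight α D R = R c ≡ false × out α R ≤ amount D R

  tight? : ∀ α D R → Dec (Tight α D R)
  tight? α D R = (R c 𝔹.≟ false) ×-dec (out α R ≤? amount D R)

  tight-ext : ∀ α D → Extensional (Tight α D)
  tight-ext α D e (p , l) = trans (sym (e c)) p , subst₂ _≤_ (out-ext α e) (ext D e) l

  -- Exits minus demand is nonnegative and submodular, and it is zero on `A` and `B`; so it is zero
  -- on both the union and the intersection.
  tight-∪∩ : ∀ α D A B → Feasible α D → Tight α D A → Tight α D B →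
             Tight α D (A ∪ᵇ B) × Tight α D (A ∩ᵇ B)
  tight-∪∩ α D A B F (p , l) (q , m) =
    (∨-false p q , linear 0 (≤-trans (+-mono-≤ sub (F (A ∩ᵇ B) (∧-falseˡ p))) ≤-refl)
        (eq (out α (A ∪ᵇ B)) (out α (A ∩ᵇ B)) (amount D (A ∪ᵇ B)) (amount D (A ∩ᵇ B)))) ,
    (∧-falseˡ p , linear 0 (+-mono-≤ sub (F (A ∪ᵇ B) (∨-false p q)))
        (eq′ (out α (A ∪ᵇ B)) (out α (A ∩ᵇ B)) (amount D (A ∪ᵇ B)) (amount D (A ∩ᵇ B))))
    where
    sub : out α (A ∪ᵇ B) + out α (A ∩ᵇ B) ≤ amount D (A ∪ᵇ B) + amount D (A ∩ᵇ B)
    sub = ≤-trans (out-submod α A B) (≤-trans (+-mono-≤ l m) (≤-reflexive (sym (modular D A B))))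
    eq : ∀ a b c d → a + ((c + d) + b) + 0 ≡ c + ((a + b) + d)
    eq a b c d = solve (a ∷ b ∷ c ∷ d ∷ [])
    eq′ : ∀ a b c d → b + ((c + d) + a) + 0 ≡ d + ((a + b) + c)
    eq′ a b c d = solve (a ∷ b ∷ c ∷ d ∷ [])

  Single : Arc → Set
  Single α = ∀ e → ¬ (α e true ≡ true × α e false ≡ true)

  -- Losing one arc costs a set at most one exit. A set violated afterwards therefore had exactly as
  -- many exits as its demand, and the arc was one of them.
  kill-violated : ∀ α D e b → Feasible α D → α e b ≡ true → ∃ (Violated (kill α e b) D) →
    ∃[ R ] (Tight α D R × crosses R e b ≡ true)
  kill-violated α D e b F αe (R , p , l) with crosses R e b in eq
  ... | true  = R , (p , ≤-trans (out-kill α e b R) (subst (_≤ amount D R) (sym lem) l)) , eq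
    where
    lem : out (kill α e b) R + b2n (α e b ∧ crosses R e b) ≡ suc (out (kill α e b) R)
    lem rewrite αe | eq = +-comm _ 1
  ... | false = ⊥-elim (<⇒≱ (<-≤-trans l (F R p)) (≤-trans (out-kill α e b R) (≤-reflexive lem)))
    where
    lem : out (kill α e b) R + b2n (α e b ∧ crosses R e b) ≡ out (kill α e b) R
    lem rewrite αe | eq = +-identityʳ _

  kill-one : ∀ α D → Feasible α D → ∀ e → α e true ≡ true → α e false ≡ true →
    ∃[ b ] Feasible (kill α e b) D
  kill-one α D F e h₁ h₂ with feasible? (kill α e true) D | feasible? (kill α e false) D
  ... | inj₁ F′ | _       = true , F′
  ... | inj₂ _  | inj₁ F′ = false , F′
  ... | inj₂ v₁ | inj₂ v₂ =
    let R , (p , l) , x = kill-violated α D e true F h₁ v₁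
        R′ , (p′ , l′) , x′ = kill-violated α D e false F h₂ v₂
        a , b = ∧⁻ {R′ (src e false)} x′
    -- The arc leaves `R` and enters `R′`, so submodularity is strict, and the union or the
    -- intersection would violate the demand.
    in ⊥-elim (<⇒≱ (<-≤-trans (out-submod-< α R R′ e true h₁ x (not⁻ b) a) (+-mono-≤ l l′))
         (subst (_≤ out α (R ∪ᵇ R′) + out α (R ∩ᵇ R′)) (modular D R R′)
           (+-mono-≤ (F (R ∪ᵇ R′) (∨-false p p′)) (F (R ∩ᵇ R′) (∧-falseˡ p)))))

  -- One of the two arcs of an edge can always be given up, since tight sets blocking each of
  -- them would violate submodularity: this makes a flow use every edge at most once.
  single : ∀ α D → Feasible α D → ∃[ β ] (Feasible β D × Single β × (∀ e b → β e b ≡ true → α e b ≡ true))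
  single α D = go (doubles α) α ≤-refl
    where
    doubles : Arc → ℕ
    doubles α = size (λ e → α e true ∧ α e false)
    go : ∀ m α → doubles α ≤ m → Feasible α D →
         ∃[ β ] (Feasible β D × Single β × (∀ e b → β e b ≡ true → α e b ≡ true))
    go m α h F with any? (λ e → (α e true 𝔹.≟ true) ×-dec (α e false 𝔹.≟ true))
    ... | no ¬q = α , F , (λ e q → ¬q (e , q)) , λ _ _ p → p
    ... | yes (e , q₁ , q₂) with kill-one α D F e q₁ q₂
    ...   | b , F′ = shrink m h
      where
      killed : ∀ b → kill α e b e true ∧ kill α e b e false ≡ false
      killed true  rewrite ==-refl e = ∧-falseˡ (∧-falseʳ {α e true} refl)
      killed false rewrite ==-refl e = ∧-falseʳ {α e true ∧ true} (∧-falseʳ {α e false} refl)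
      smaller : doubles (kill α e b) < doubles α
      smaller = size-mono-< (λ e′ p → let p₁ , p₂ = ∧⁻ {kill α e b e′ true} p in
                               ∧⁺ (kill⁻ α e b e′ true p₁) (kill⁻ α e b e′ false p₂)) e (killed b) (∧⁺ q₁ q₂)
      shrink : ∀ m → doubles α ≤ m → _
      shrink zero    h = ⊥-elim (<⇒≱ smaller (≤-trans h z≤n))
      shrink (suc m) h = let β , F″ , s , sub = go m (kill α e b) (≤-pred (≤-trans smaller h)) F′
                       in β , F″ , s , λ e′ b′ → kill⁻ α e b e′ b′ ∘ sub e′ b′

  private
    -- For one set: `s` and `t` tell whether it contains the source and the target of the arc, `O`
    -- and `K` are its exits before and after the arc is killed, and `D` is the demand apart from
    -- the moved unit. Only a set with the target but without the source has to pay more, and by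
    -- assumption it is not tight.
    pushed : ∀ {D O K a} s t → a ≡ true → (s ≡ false → t ≡ true → O ≤ D + 0 → ⊥) →
      D + b2n s ≤ O → O ≤ K + b2n (a ∧ (s ∧ not t)) → D + b2n t ≤ K
    pushed true  true  refl _ f k = ≤-trans f (≤-trans k (≤-reflexive (+-identityʳ _)))
    pushed true  false refl _ f k = ≤-trans (≤-reflexive (+-identityʳ _)) (+-cancelʳ-≤ 1 _ _ (≤-trans f k))
    pushed false false refl _ f k = ≤-trans f (≤-trans k (≤-reflexive (+-identityʳ _)))
    pushed {D} false true refl h f k = ≤-trans (≤-reflexive (+-suc D 0))
      (≤-trans (≰⇒> (h refl refl)) (≤-trans k (≤-reflexive (+-identityʳ _))))

  -- An arc that leaves u and the largest tight set avoiding u will do.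
  push : ∀ α D u → Feasible α (D ⊕ at u) → u ≢ c →
    ∃[ e ] ∃[ b ] (α e b ≡ true × src e b ≡ u × Feasible (kill α e b) (D ⊕ at (dst e b)))
  push α D u F u≢c = found (∑ₐ-witness gain)
    where
    D⁺ = D ⊕ at u
    Avoids : Sub (#V G) → Set
    Avoids R = R u ≡ false × Tight α D⁺ R
    mx = maximal {P = Avoids} (λ R → (R u 𝔹.≟ false) ×-dec tight? α D⁺ R)
      (λ {A} {B} e (p , t) → trans (sym (e u)) p , tight-ext α D⁺ {A} {B} e t) ∅ᵇ (refl , refl ,
        ≤-trans (≤-reflexive (out-∅ α)) z≤n)
    R = proj₁ mx
    R-avoids : R u ≡ false
    R-avoids = proj₁ (proj₁ (proj₂ (proj₂ mx)))
    R-tight : Tight α D⁺ R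
    R-tight = proj₂ (proj₁ (proj₂ (proj₂ mx)))
    c∉ : insert u R c ≡ false
    c∉ with c ≟ᶠ u
    ... | yes refl = ⊥-elim (u≢c refl)
    ... | no _     = trans (𝔹.∨-identityʳ (R c)) (proj₁ R-tight)
    -- `R` is tight without `u`, and adding `u` adds its unit of demand; hence some arc leaves
    -- `insert u R` that does not leave `R`, and it must start at `u`.
    gain : out α R < out α (insert u R)
    gain = begin-strict
      out α R                                ≤⟨ proj₂ R-tight ⟩
      amount D R + b2n (R u)                 ≡⟨ cong (λ x → amount D R + b2n x) R-avoids ⟩
      amount D R + 0                         ≤⟨ +-monoˡ-≤ 0 (mono D (λ _ → ∨ˡ)) ⟩
      amount D (insert u R) + 0              <⟨ +-monoʳ-< (amount D (insert u R)) ≤-refl ⟩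
      amount D (insert u R) + 1              ≡⟨ cong (λ x → amount D (insert u R) + b2n x) (∨ʳ {R u} (==-refl u)) ⟨
      amount D (insert u R) + b2n (insert u R u) ≤⟨ F (insert u R) c∉ ⟩
      out α (insert u R)                     ∎
      where open ≤-Reasoning
    found : ∃[ e ] ∃[ b ] b2n (α e b ∧ crosses R e b) < b2n (α e b ∧ crosses (insert u R) e b) → _
    found (e , b , l) with
        toWitness {a? = all𝔹 λ a → all𝔹 λ x → all𝔹 λ x′ → all𝔹 λ y → all𝔹 λ y′ →
          (b2n (a ∧ x ∧ not y) <? b2n (a ∧ (x ∨ x′) ∧ not (y ∨ y′))) →-dec
          ((a 𝔹.≟ true) ×-dec (x′ 𝔹.≟ true) ×-dec (y 𝔹.≟ false))} _
          (α e b) (R (src e b)) (src e b == u) (R (dst e b)) (dst e b == u) l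
    ... | αe , x′ , y = e , b , αe , src≡u , feasible
      where
      src≡u : src e b ≡ u
      src≡u = ==⇒≡ x′
      feasible : Feasible (kill α e b) (D ⊕ at (dst e b))
      -- A tight `R′` with the target but without `u` would unite with `R` to a larger tight set
      -- avoiding `u`, although the target lies outside the maximal one.
      feasible R′ c∉R′ = pushed (R′ (src e b)) (R′ (dst e b)) αe
        (λ s t l′ → contra (proj₂ (proj₂ (proj₂ mx)) {R ∪ᵇ R′} (λ _ → ∨ˡ)
          (∨-false R-avoids (trans (cong R′ (sym src≡u)) s) ,
           proj₁ (tight-∪∩ α D⁺ R R′ F R-tight (c∉R′ , subst (λ v → out α R′ ≤ amount D R′ + b2n (R′ v)) src≡u
             (subst (λ x → out α R′ ≤ amount D R′ + b2n x) (sym s) l′))))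
          (dst e b) (∨ʳ {R (dst e b)} t)) y)
        (subst (λ v → amount D R′ + b2n (R′ v) ≤ out α R′) (sym src≡u) (F R′ c∉R′))
        (out-kill α e b R′)

-- Sparse edge sets that preserve the connectivity of the terminals.

module Sparsify (G : Graph) (c : V G) (S : Sub (#V G)) (k : ℕ) where

  open Arcs G

  cut : Sub (#E G) → Sub (#V G) → ℕ
  cut M = out (λ e _ → M e)

  cut-submod : ∀ M A B → cut M (A ∪ᵇ B) + cut M (A ∩ᵇ B) ≤ cut M A + cut M B
  cut-submod M = out-submod (λ e _ → M e)

  cut-ext : ∀ M {A B} → A ≗ B → cut M A ≡ cut M B
  cut-ext M = out-ext (λ e _ → M e)

  cut-∁ : ∀ M A → cut M (not ∘ A) ≡ cut M A
  cut-∁ M A = trans (∑ₐ-flip (λ e b → b2n (M e ∧ crosses (not ∘ A) e b)))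
    (∑ₐ-cong λ { e true  → cong b2n (lem (M e) (A (end₁ G e)) (A (end₂ G e)))
               ; e false → cong b2n (lem (M e) (A (end₂ G e)) (A (end₁ G e))) })
    where
    lem : ∀ m x y → m ∧ (not y ∧ not (not x)) ≡ m ∧ (x ∧ not y)
    lem = toWitness {a? = all𝔹 λ m → all𝔹 λ x → all𝔹 λ y → _ 𝔹.≟ _} _

  -- Submodularity for `A` and the complement of `B`; complementing a set does not change its cut.
  cut-posimod : ∀ M A B → cut M (A ∖ᵇ B) + cut M (B ∖ᵇ A) ≤ cut M A + cut M B
  cut-posimod M A B = subst₂ _≤_
    (trans (+-comm (cut M (A ∪ᵇ (not ∘ B))) _)
      (cong (cut M (A ∖ᵇ B) +_) (trans (sym (cut-∁ M (A ∪ᵇ (not ∘ B))))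
        (cut-ext M (λ i → lem (A i) (B i))))))
    (cong (cut M A +_) (cut-∁ M B))
    (cut-submod M A (not ∘ B))
    where
    lem : ∀ a b → not (a ∨ not b) ≡ b ∧ not a
    lem = toWitness {a? = all𝔹 λ a → all𝔹 λ b → _ 𝔹.≟ _} _

  cut-remove : ∀ M e b R → crosses R e b ≡ true → cut M R ≤ suc (cut (remove e M) R)
  cut-remove M e b R eq = ≤-trans (out-kill (λ e _ → M e) e b R) (≤-trans (+-mono-≤
      (out-mono (kill (λ e _ → M e) e b) (λ e′ _ → remove e M e′) R λ e′ b′ cr q → let q₁ , q₂ = ∧⁻ {M e′} q in
        ∧⁺ q₁ (cong not (¬true λ h → opposite e b e′ b′ (==⇒≡ h) eq cr (not⁻ q₂))))
      (b2n≤1 (M e ∧ crosses R e b))) (≤-reflexive (+-comm _ 1)))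
    where
    b2n≤1 : ∀ x → b2n x ≤ 1
    b2n≤1 true  = ≤-refl
    b2n≤1 false = z≤n
    opposite : ∀ e b e′ b′ → e′ ≡ e → crosses R e b ≡ true → crosses R e′ b′ ≡ true → is e b e′ b′ ≡ false → ⊥
    opposite e b e′ b′ refl h h′ q rewrite ==-refl e with ∧⁻ {R (src e b)} h | ∧⁻ {R (src e b′)} h′
    opposite e true  _ false refl h h′ q | u , _ | _ , v = contra u (not⁻ v)
    opposite e false _ true  refl h h′ q | u , _ | _ , v = contra u (not⁻ v)

  Connects : Sub (#E G) → Set
  Connects M = ∀ R → R c ≡ false → ∀ x → S x ≡ true → R x ≡ true → k ≤ cut M R

  SmallCut : Sub (#E G) → Sub (#V G) → Set
  SmallCut M R = R c ≡ false × (∃[ x ] (S x ≡ true × R x ≡ true)) × cut M R < k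

  smallCut? : ∀ M → Dec (∃ (SmallCut M))
  smallCut? M = search (λ R → (R c 𝔹.≟ false) ×-dec
      any? (λ x → (S x 𝔹.≟ true) ×-dec (R x 𝔹.≟ true)) ×-dec (cut M R <? k))
    λ e (p , (x , s , r) , l) → trans (sym (e c)) p , (x , s , trans (sym (e x)) r) , subst (_< k) (cut-ext M e) l

  connects? : ∀ M → Dec (Connects M)
  connects? M = map′ (λ ¬s R p x s r → ≮⇒≥ λ l → ¬s (R , p , (x , s , r) , l))
    (λ h (R , p , (x , s , r) , l) → <⇒≱ l (h R p x s r)) (¬? (smallCut? M))

  connects-ext : Extensional Connects
  connects-ext {M} {M′} e h R p x s r = ≤-trans (h R p x s r) (out-mono (λ e _ → M e) (λ e _ → M′ e) R (λ e′ _ _ → trans (sym (e e′))))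

  module _ (M : Sub (#E G)) (conn : Connects M) (crit : ∀ e → M e ≡ true → ¬ Connects (remove e M)) where

    Tight : Sub (#V G) → Set
    Tight R = R c ≡ false × (∃[ x ] (S x ≡ true × R x ≡ true)) × cut M R ≤ k

    tight? : ∀ R → Dec (Tight R)
    tight? R = (R c 𝔹.≟ false) ×-dec
      any? (λ x → (S x 𝔹.≟ true) ×-dec (R x 𝔹.≟ true)) ×-dec (cut M R ≤? k)

    tight-ext : Extensional Tight
    tight-ext e (p , (x , s , r) , l) =
      trans (sym (e c)) p , (x , s , trans (sym (e x)) r) , subst (_≤ k) (cut-ext M e) l

    private
      split : ∀ {a b a′ b′} → a + b ≤ a′ + b′ → a′ ≤ k → b′ ≤ k → k ≤ a → k ≤ b → a ≤ k × b ≤ k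
      split {a} {b} h p q r s =
        +-cancelʳ-≤ b a k (≤-trans h (≤-trans (+-mono-≤ p q) (+-monoʳ-≤ k s))) ,
        +-cancelˡ-≤ a b k (≤-trans h (≤-trans (+-mono-≤ p q) (+-monoˡ-≤ k r)))

    -- The common terminal is what guarantees that union and intersection both have cut at least
    -- `k`, so that the submodular inequality is squeezed.
    tight-∪∩ : ∀ A B → Tight A → Tight B → ∀ x → S x ≡ true → A x ≡ true → B x ≡ true →
               Tight (A ∪ᵇ B) × Tight (A ∩ᵇ B)
    tight-∪∩ A B (p , _ , l) (q , _ , m) x s a b =
      let l₁ , l₂ = split (cut-submod M A B) l m (conn _ (∨-false p q) x s (∨ˡ a)) (conn _ (∧-falseˡ p) x s (∧⁺ a b))
      in (∨-false p q , (x , s , ∨ˡ a) , l₁) , (∧-falseˡ p , (x , s , ∧⁺ a b) , l₂)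

    -- The same squeeze by posimodularity; here each difference must contain a terminal.
    tight-∖ : ∀ A B → Tight A → Tight B → ∀ x → S x ≡ true → A x ≡ true → B x ≡ false →
              ∀ y → S y ≡ true → B y ≡ true → A y ≡ false → Tight (A ∖ᵇ B)
    tight-∖ A B (p , _ , l) (q , _ , m) x s a b y t b′ a′ =
      let l₁ , _ = split (cut-posimod M A B) l m (conn _ (∧-falseˡ p) x s (∧⁺ a (cong not b)))
                         (conn _ (∧-falseˡ q) y t (∧⁺ b′ (cong not a′)))
      in ∧-falseˡ p , (x , s , ∧⁺ a (cong not b)) , l₁

    critical : ∀ e → M e ≡ true → ∃[ R ] (Tight R × ∃[ b ] crosses R e b ≡ true)
    critical e Me with smallCut? (remove e M)
    ... | no ¬s = ⊥-elim (crit e Me λ R p x s r → ≮⇒≥ λ l → ¬s (R , p , (x , s , r) , l))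
    ... | yes (R , p , (x , s , r) , l) with crosses R e true in eq | crosses R e false in eq′
    ...   | true  | _     = R , (p , (x , s , r) , ≤-trans (cut-remove M e true R eq) l) , true , eq
    ...   | false | true  = R , (p , (x , s , r) , ≤-trans (cut-remove M e false R eq′) l) , false , eq′
    ...   | false | false = ⊥-elim (<⇒≱ l (≤-trans (conn R p x s r)
              (out-mono (λ e _ → M e) (λ e′ _ → remove e M e′) R λ e′ b′ cr m → ∧⁺ m (cong not (¬true λ h → uncrossed e′ b′ (==⇒≡ h) cr)))))
      where
      uncrossed : ∀ e′ b′ → e′ ≡ e → crosses R e′ b′ ≡ true → ⊥
      uncrossed e′ true  refl cr = contra cr eq
      uncrossed e′ false refl cr = contra cr eq′

    CoreCandidate : V G → Sub (#V G) → Set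
    CoreCandidate x A = A x ≡ true × (Tight A ⊎ (∀ v → A v ≡ true))

    abstract
      -- The least tight set containing x, or everything if there is none.
      core-spec : ∀ x → ∃[ A ] Minimal (CoreCandidate x) A
      core-spec x = let A , _ , mn = minimal
                          (λ A → (A x 𝔹.≟ true) ×-dec (tight? A ⊎-dec all? (λ v → A v 𝔹.≟ true)))
                          (λ { e (p , inj₁ t) → trans (sym (e x)) p , inj₁ (tight-ext e t)
                             ; e (p , inj₂ f) → trans (sym (e x)) p , inj₂ (λ v → trans (sym (e v)) (f v)) })
                          (λ _ → true) (refl , inj₂ (λ _ → refl))
                    in A , mn

      core : V G → Sub (#V G)
      core x = proj₁ (core-spec x)

      core-∋ : ∀ x → core x x ≡ true
      core-∋ x = proj₁ (proj₁ (proj₂ (core-spec x)))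

      core-kind : ∀ x → Tight (core x) ⊎ (∀ v → core x v ≡ true)
      core-kind x = proj₂ (proj₁ (proj₂ (core-spec x)))

      core-minimal : ∀ x {B} → B ⊑ core x → CoreCandidate x B → core x ⊑ B
      core-minimal x = proj₂ (proj₂ (core-spec x))

    -- Tight sets around the terminal `x` share it and so are closed under intersection; thus the
    -- minimal one is the least one.
    core-least : ∀ {x} → S x ≡ true → ∀ {B} → CoreCandidate x B → core x ⊑ B
    core-least Sx (_ , inj₂ all) i _ = all i
    core-least {x} Sx {B} (Bx , inj₁ t) i p with core-kind x
    ... | inj₁ tc = proj₂ (∧⁻ {core x i} (core-minimal x {core x ∩ᵇ B}
            (λ j q → proj₁ (∧⁻ q))
            (∧⁺ (core-∋ x) Bx , inj₁ (proj₂ (tight-∪∩ (core x) B tc t x Sx (core-∋ x) Bx))) i p))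
    ... | inj₂ all = core-minimal x {B} (λ j _ → all j) (Bx , inj₁ t) i p

    cut-⊤ : ∀ {A} → (∀ v → A v ≡ true) → cut M A ≡ 0
    cut-⊤ {A} all = trans (∑ₐ-cong {g = λ _ _ → 0} λ e b → lem (M e) (A (src e b)) (all (dst e b)))
        (trans (∑ₐ-def _) (sum-zero (#E G)))
      where
      lem : ∀ m x {y} → y ≡ true → b2n (m ∧ x ∧ not y) ≡ 0
      lem m x refl rewrite 𝔹.∧-zeroʳ x | 𝔹.∧-zeroʳ m = refl

    cut-core : ∀ x → cut M (core x) ≤ k
    cut-core x with core-kind x
    ... | inj₁ (_ , _ , l) = l
    ... | inj₂ all         = ≤-trans (≤-reflexive (cut-⊤ all)) z≤n

    -- Tight sets cannot tell two parents of y apart.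
    Parent : V G → V G → Set
    Parent y x = S x ≡ true × core x y ≡ true × core y x ≡ false ×
      (∀ z → S z ≡ true → core z y ≡ true → core y z ≡ false → core z x ≡ true)

    parent? : ∀ y x → Dec (Parent y x)
    parent? y x = (S x 𝔹.≟ true) ×-dec (core x y 𝔹.≟ true) ×-dec (core y x 𝔹.≟ false) ×-dec
      all? (λ z → (S z 𝔹.≟ true) →-dec (core z y 𝔹.≟ true) →-dec (core y z 𝔹.≟ false) →-dec (core z x 𝔹.≟ true))

    -- Such a set separates `y` from its parents. In the tree of cores it stands for the tree edge
    -- above `y`, as `core y` stands for the node.
    Branch : V G → Sub (#V G) → Set
    Branch y A = Tight A × A y ≡ true × ∃[ x ] (Parent y x × A x ≡ false)

    branch? : ∀ y A → Dec (Branch y A)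
    branch? y A = tight? A ×-dec (A y 𝔹.≟ true) ×-dec any? (λ x → parent? y x ×-dec (A x 𝔹.≟ false))

    branch-ext : ∀ y → Extensional (Branch y)
    branch-ext y e (t , p , x , q , r) = tight-ext e t , trans (sym (e y)) p , x , q , trans (sym (e x)) r

    abstract
      branch-spec : ∀ y → ∃[ A ] (Maximal (Branch y) A ⊎ (A ≡ ∅ᵇ × ¬ ∃ (Branch y)))
      branch-spec y with search (branch? y) (branch-ext y)
      ... | no ¬b = ∅ᵇ , inj₂ (refl , ¬b)
      ... | yes (A , b) = let B , _ , mx = maximal (branch? y) (branch-ext y) A b in B , inj₁ mx

      branch : V G → Sub (#V G)
      branch y = proj₁ (branch-spec y)

      branch-kind : ∀ y → Maximal (Branch y) (branch y) ⊎ (branch y ≡ ∅ᵇ × ¬ ∃ (Branch y))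
      branch-kind y = proj₂ (branch-spec y)

    cut-branch : ∀ y → cut M (branch y) ≤ k
    cut-branch y with branch-kind y
    ... | inj₁ (((_ , _ , l) , _) , _) = l
    ... | inj₂ (eq , _) = ≤-trans (≤-reflexive (trans (cong (cut M) eq) (trans (sym (cut-∁ M ∅ᵇ)) (cut-⊤ {λ _ → true} λ _ → refl)))) z≤n

    -- The union with `branch y` is tight and still misses a parent: a tight set containing one
    -- parent contains its core, hence all the other parents.
    branch-greatest : ∀ {x y} A → S y ≡ true → Parent y x → Tight A → A y ≡ true → A x ≡ false →
      A ⊑ branch y × branch y x ≡ false
    branch-greatest {x} {y} A Sy par t Ay Ax with branch-kind y
    ... | inj₂ (_ , ¬b) = ⊥-elim (¬b (A , t , Ay , x , par , Ax))
    ... | inj₁ ((tN , Ny , x′ , par′ , Nx′) , mx) =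
      (λ i a → mx {branch y ∪ᵇ A} (λ _ → ∨ˡ)
         (proj₁ (tight-∪∩ (branch y) A tN t y Sy Ny Ay) , ∨ˡ Ny , x′ , par′ ,
          ∨-false Nx′ (¬true λ Ax′ → contra (core-least (proj₁ par′) (Ax′ , inj₁ t) x (same par par′)) Ax)) i (∨ʳ {branch y i} a)) ,
      ¬true λ Nx → contra (core-least (proj₁ par) (Nx , inj₁ tN) x′ (same par′ par)) Nx′
      where
      same : ∀ {x z} → Parent y x → Parent y z → core z x ≡ true
      same (_ , _ , _ , h) (Sz , zy , yz , _) = h _ Sz zy yz

    Apart : V G → V G → Sub (#V G) → Set
    Apart u x A = Tight A × A u ≡ true × A x ≡ false

    apart? : ∀ u x A → Dec (Apart u x A)
    apart? u x A = tight? A ×-dec (A u 𝔹.≟ true) ×-dec (A x 𝔹.≟ false)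

    apart-ext : ∀ u x → Extensional (Apart u x)
    apart-ext u x e (t , p , q) = tight-ext e t , trans (sym (e u)) p , trans (sym (e x)) q

    Common : V G → Sub (#V G) → V G → Set
    Common x A y = S y ≡ true × A y ≡ true × core x y ≡ true

    common? : ∀ x A y → Dec (Common x A y)
    common? x A y = (S y 𝔹.≟ true) ×-dec (A y 𝔹.≟ true) ×-dec (core x y 𝔹.≟ true)

    -- The terminal that makes `A` tight lies in `core x`. Otherwise `core x ∖ᵇ A` would be a tight
    -- set around `x` without `u`, against the minimality of `core x`.
    meets : ∀ {x u} A → S x ≡ true → core x u ≡ true → Apart u x A → ∃ (Common x A)
    meets {x} {u} A Sx inside (tA , Au , Ax) with core-kind x | proj₁ (proj₂ tA)
    ... | inj₂ all | w , Sw , Aw = w , Sw , Aw , all w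
    ... | inj₁ tc  | w , Sw , Aw with core x w in xw
    ...   | true  = w , Sw , Aw , xw
    ...   | false = ⊥-elim (contra Au (not⁻ (proj₂ (∧⁻ {core x u} (core-least Sx {core x ∖ᵇ A}
              (∧⁺ (core-∋ x) (cong not Ax) , inj₁ (tight-∖ (core x) A tc tA x Sx (core-∋ x) Ax w Sw Aw xw)) u inside)))))

    -- Otherwise `core z ∖ᵇ core x` would be a tight set around `z` that misses `y`, against the
    -- minimality of `core z`.
    core-overlap : ∀ {x y z} → S x ≡ true → S z ≡ true → core x y ≡ true → core z y ≡ true →
      Tight (core z) → core z x ≡ false → core x z ≡ true
    core-overlap {x} {y} {z} Sx Sz xy zy tz zx with core x z in eq | core-kind x
    ... | true  | _        = refl
    ... | false | inj₂ all = contra (all z) eq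
    ... | false | inj₁ tx  = contra xy (not⁻ (proj₂ (∧⁻ {core z y} (core-least Sz {core z ∖ᵇ core x}
            (∧⁺ (core-∋ z) (cong not eq) , inj₁ (tight-∖ (core z) (core x) tz tx z Sz (core-∋ z) eq x Sx (core-∋ x) zx)) y zy))))

    -- If a core containing `y` and properly containing `core y` missed `x`, then it could be united
    -- with the maximal `A`; its terminal `z` would lie in `A` and, by `core-overlap`, in `core x`,
    -- against the choice of `y` with the largest core.
    top-parent : ∀ {x u y} A → S x ≡ true → Maximal (Apart u x) A → Common x A y →
      (∀ z → Common x A z → size (core z) ≤ size (core y)) → Parent y x
    top-parent {x} {u} {y} A Sx ((tA , Au , Ax) , mx) (Sy , Ay , xy) top =
      Sx , xy , ¬true (λ yx → contra (core-least Sy (Ay , inj₁ tA) x yx) Ax) , climb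
      where
      climb : ∀ z → S z ≡ true → core z y ≡ true → core y z ≡ false → core z x ≡ true
      climb z Sz zy yz with core z x in zx | core-kind z
      ... | true  | _        = refl
      ... | false | inj₂ all = contra (all x) zx
      ... | false | inj₁ tz  = ⊥-elim (<⇒≱ (size-mono-< (core-least Sy (zy , inj₁ tz)) z yz (core-∋ z))
              (top z (Sz , mx {A ∪ᵇ core z} (λ _ → ∨ˡ)
                  (proj₁ (tight-∪∩ A (core z) tA tz y Sy Ay zy) , ∨ˡ Au , ∨-false Ax zx) z (∨ʳ {A z} (core-∋ z)) ,
                core-overlap Sx Sz xy zy tz zx)))

    -- The edges of M at the terminals are charged to terminals y, at most 2 k to each: to the edges
    -- leaving core y and to those entering branch y.
    charge : ∀ e b → M e ≡ true → S (src e b) ≡ true →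
      ∃[ y ] (S y ≡ true × (crosses (core y) e b ≡ true ⊎
                            (branch y (dst e b) ≡ true × branch y (src e b) ≡ false)))
    charge e b Me Sx with core (src e b) (dst e b) in inside
    ... | false = src e b , Sx , inj₁ (∧⁺ (core-∋ (src e b)) (cong not inside))
    ... | true  =
      let R , ap = start
          A , _ , mx = maximal (apart? u x) (apart-ext u x) R ap
          y , com , top = argmax (common? x A) (size ∘ core) (meets A Sx inside (proj₁ mx))
          f , g = branch-greatest A (proj₁ com) (top-parent A Sx mx com top) (proj₁ (proj₁ mx)) (proj₁ (proj₂ com)) (proj₂ (proj₂ (proj₁ mx)))
      in y , proj₁ com , inj₂ (f u (proj₁ (proj₂ (proj₁ mx))) , g)
      where
      x = src e b
      u = dst e b
      sides : ∀ b b′ R → crosses R e b′ ≡ true →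
        (R (src e b) ≡ true × R (dst e b) ≡ false) ⊎ (R (dst e b) ≡ true × R (src e b) ≡ false)
      sides true  true  R h = let p , q = ∧⁻ h in inj₁ (p , not⁻ q)
      sides true  false R h = let p , q = ∧⁻ h in inj₂ (p , not⁻ q)
      sides false true  R h = let p , q = ∧⁻ h in inj₂ (p , not⁻ q)
      sides false false R h = let p , q = ∧⁻ h in inj₁ (p , not⁻ q)
      start : ∃ (Apart u x)
      start with critical e Me
      ... | R , t , b′ , cr with sides b b′ R cr
      -- A tight set around `x` contains `core x` and therefore `u`; so the tight cut through `e`
      -- has `u`, not `x`, on its inner side.
      ...   | inj₁ (p , q) = ⊥-elim (contra (core-least Sx (p , inj₁ t) u inside) q)
      ...   | inj₂ (p , q) = R , t , p , q

    degree-sum : ∑ₐ (λ e b → b2n (M e ∧ S (src e b))) ≤ 2 * k * size S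
    degree-sum = begin
      ∑ₐ (λ e b → b2n (M e ∧ S (src e b)))          ≤⟨ ∑ₐ-mono charged ⟩
      ∑ₐ (λ e b → sum (λ y → charges y e b))        ≡⟨ ∑ₐ-sum charges ⟩
      sum (λ y → ∑ₐ (charges y))                    ≤⟨ sum-mono total ⟩
      sum (λ y → 2 * k * b2n (S y))                 ≡⟨ sum-*ˡ (2 * k) (b2n ∘ S) ⟩
      2 * k * size S                                ∎
      where
      open ≤-Reasoning
      charges : V G → E G → Bool → ℕ
      -- The charged arc enters `branch y`, so it is the reversed arc, with `not b`, that is counted
      -- in the cut.
      charges y e b = if S y then b2n (M e ∧ crosses (core y) e b) + b2n (M e ∧ crosses (branch y) e (not b)) else 0
      charged : ∀ e b → b2n (M e ∧ S (src e b)) ≤ sum (λ y → charges y e b)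
      charged e b = b2n≤ (M e ∧ S (src e b)) λ h →
        let m , s = ∧⁻ {M e} h
            y , Sy , ch = charge e b m s
        in ≤-trans (one m y Sy ch) (term≤sum (λ y → charges y e b) y)
        where
        reverse : ∀ b y → branch y (dst e b) ≡ true → branch y (src e b) ≡ false → crosses (branch y) e (not b) ≡ true
        reverse true  y p q = ∧⁺ p (cong not q)
        reverse false y p q = ∧⁺ p (cong not q)
        one : M e ≡ true → ∀ y → S y ≡ true → crosses (core y) e b ≡ true ⊎
          (branch y (dst e b) ≡ true × branch y (src e b) ≡ false) → 1 ≤ charges y e b
        one m y Sy (inj₁ cr) rewrite Sy | m | cr = s≤s z≤n
        one m y Sy (inj₂ (p , q)) rewrite Sy | m | reverse b y p q = m≤n+m 1 _
      total : ∀ y → ∑ₐ (charges y) ≤ 2 * k * b2n (S y)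
      total y with S y
      ... | false = ≤-trans (≤-reflexive (trans (∑ₐ-def _) (sum-zero (#E G)))) z≤n
      ... | true  = begin
        ∑ₐ (λ e b → b2n (M e ∧ crosses (core y) e b) + b2n (M e ∧ crosses (branch y) e (not b)))
          ≡⟨ ∑ₐ-+ _ _ ⟩
        cut M (core y) + ∑ₐ (λ e b → b2n (M e ∧ crosses (branch y) e (not b)))
          ≡⟨ cong (cut M (core y) +_) (sym (∑ₐ-flip (λ e b → b2n (M e ∧ crosses (branch y) e b)))) ⟩
        cut M (core y) + cut M (branch y)  ≤⟨ +-mono-≤ (cut-core y) (cut-branch y) ⟩
        k + k                              ≡⟨ solve (k ∷ []) ⟩
        2 * k * 1                          ∎

  sparsify : Connects (λ _ → true) →
    ∃[ M ] (Connects M × ∑ₐ (λ e b → b2n (M e ∧ S (src e b))) ≤ 2 * k * size S)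
  sparsify conn =
    let M , _ , connM , mn = minimal connects? connects-ext (λ _ → true) conn
    in M , connM , degree-sum M connM λ e Me conn⁻ →
         contra (mn {remove e M} (λ i p → proj₁ (∧⁻ p)) conn⁻ e Me) (∧-falseʳ {M e} (cong not (==-refl e)))

-- Changing a demand by one unit at one vertex.

bump : ∀ {n} → Fin n → (Fin n → ℕ) → Fin n → ℕ
bump t b v = b v + (if v == t then 1 else 0)

sum-bump : ∀ {n} t (b r : Fin n → ℕ) → sum (λ v → bump t b v * r v) ≡ sum (λ v → b v * r v) + r t
sum-bump t b r = trans (sum-cong-≗ (λ v → trans (*-distribʳ-+ (r v) (b v) _) (cong (b v * r v +_) (lem (v == t)))))
  (trans (∑-distrib-+ (λ v → b v * r v) _) (cong (sum (λ v → b v * r v) +_) (sum-δ r t)))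
  where
  lem : ∀ q {x} → (if q then 1 else 0) * x ≡ (if q then x else 0)
  lem true  = *-identityˡ _
  lem false = refl

bump-remove : ∀ {n} {A : Sub n} y → A y ≡ true → b2n ∘ A ≗ bump y (b2n ∘ remove y A)
bump-remove {A = A} y Ay v with v ≟ᶠ y
... | yes refl rewrite Ay = refl
... | no _ = sym (trans (+-identityʳ _) (cong b2n (𝔹.∧-identityʳ (A v))))

on-remove : ∀ {n} (A : Sub n) y → A y ≡ true → ∀ R → amount (on A) R ≡ amount (on (remove y A)) R + b2n (R y)
on-remove A y Ay R = trans (sum-cong-≗ (λ v → cong (_* b2n (R v)) (bump-remove {A = A} y Ay v)))
  (sum-bump y (b2n ∘ remove y A) (b2n ∘ R))

sum-*1 : ∀ {n} (b : Fin n → ℕ) → sum b ≡ sum (λ v → b v * 1)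
sum-*1 b = sum-cong-≗ (λ v → sym (*-identityʳ (b v)))

size-remove : ∀ {n} (A : Sub n) y → A y ≡ true → size A ≡ size (remove y A) + 1
size-remove A y Ay = trans (sum-*1 (b2n ∘ A)) (trans (on-remove A y Ay (λ _ → true)) (cong (_+ 1) (sym (sum-*1 (b2n ∘ remove y A)))))

total-bump : ∀ {n} t (b : Fin n → ℕ) → sum (bump t b) ≡ sum b + 1
total-bump t b = trans (sum-*1 (bump t b)) (trans (sum-bump t b (λ _ → 1)) (cong (_+ 1) (sym (sum-*1 b))))

-- Raising the selected terminals to `k` units at the expense of the others.

module Release (G : Graph) (c : V G) where

  open Flow G c public

  -- Arcs may leave `W` but not enter it, so vertices of `W` can send flow while no flow passes
  -- through them.
  avoid : Sub (#V G) → Arc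
  avoid W e b = not (W (dst e b))

  module _ (k : ℕ) (S T : Sub (#V G)) (T⊑S : T ⊑ S)
           (star : Feasible (avoid S) (on S))
           (full : Feasible (avoid T) (k · on T)) where

    -- Terminals in T send b units each, those in A one unit each, and neither are used for transit.
    record State (b : V G → ℕ) (A : Sub (#V G)) : Set where
      field
        bound    : ∀ v → b v ≤ k * b2n (T v)
        within   : A ⊑ S
        disjoint : ∀ v → A v ≡ true → T v ≡ false
        lost     : size S ≤ size T + size A + sum b
        feasible : Feasible (avoid (T ∪ᵇ A)) (weight b ⊕ on A)

    open State

    Released : Set
    Released = ∃[ A ] (A ⊑ S × (∀ v → A v ≡ true → T v ≡ false) ×
      size S ≤ size T + size A + k * size T × Feasible (avoid (T ∪ᵇ A)) (k · on T ⊕ on A))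

    private
      k*sum : ∀ (R : Sub (#V G)) → sum (λ v → k * b2n (T v) * b2n (R v)) ≡ k * sum (λ v → b2n (T v) * b2n (R v))
      k*sum R = trans (sum-cong-≗ (λ v → *-assoc k (b2n (T v)) (b2n (R v)))) (sum-*ˡ k (λ v → b2n (T v) * b2n (R v)))

      b≤ : ∀ {b A} → State b A → sum b ≤ k * size T
      b≤ st = ≤-trans (sum-mono (bound st)) (≤-reflexive (sum-*ˡ k (b2n ∘ T)))

    finish : ∀ {b A} → State b A → (∀ t → T t ≡ true → k ≤ b t) → Released
    finish {b} {A} st h = A , within st , disjoint st ,
      ≤-trans (lost st) (+-monoʳ-≤ (size T + size A) (b≤ st)) ,
      λ R p → ≤-trans (+-monoˡ-≤ _ (≤-trans (≤-reflexive (sym (k*sum R)))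
        (sum-mono (λ v → *-monoˡ-≤ (b2n (R v)) (lem v))))) (feasible st R p)
      where
      lem : ∀ v → k * b2n (T v) ≤ b v
      lem v with T v in eq
      ... | true  = ≤-trans (≤-reflexive (*-identityʳ k)) (h v eq)
      ... | false = ≤-trans (≤-reflexive (*-zeroʳ k)) z≤n

    bound-bump : ∀ {b A t} → State b A → T t ≡ true → b t < k → ∀ v → bump t b v ≤ k * b2n (T v)
    bound-bump {b} {A} {t} st Tt bt v with v ≟ᶠ t
    ... | yes refl rewrite Tt | *-identityʳ k = ≤-trans (≤-reflexive (+-comm (b v) 1)) bt
    ... | no _     = ≤-trans (≤-reflexive (+-identityʳ (b v))) (bound st v)

    raise : ∀ {b A t} → State b A → T t ≡ true → b t < k →
      Feasible (avoid (T ∪ᵇ A)) ((weight b ⊕ on A) ⊕ at t) → State (bump t b) A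
    raise {b} {A} {t} st Tt bt F = record
      { bound = bound-bump st Tt bt ; within = within st ; disjoint = disjoint st
      ; lost = ≤-trans (lost st) (+-monoʳ-≤ (size T + size A) (≤-trans (m≤m+n (sum b) 1) (≤-reflexive (sym (total-bump t b)))))
      ; feasible = λ R p → ≤-trans (≤-reflexive (trans (cong (_+ amount (on A) R) (sum-bump t b (b2n ∘ R)))
          (lem (amount (weight b) R) (b2n (R t)) (amount (on A) R)))) (F R p) }
      where
      lem : ∀ x y z → x + y + z ≡ x + z + y
      lem x y z = solve (x ∷ y ∷ z ∷ [])

    -- When b t cannot be raised, the least tight set around t contains or touches a terminal of A;
    -- that terminal gives up its own unit and may be used for transit.
    module Stuck {b A t} (st : State b A) (Tt : T t ≡ true) (bt : b t < k)
                 (viol : ∃ (Violated (avoid (T ∪ᵇ A)) ((weight b ⊕ on A) ⊕ at t))) where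

      α : Arc
      α = avoid (T ∪ᵇ A)

      D : Demand (#V G)
      D = weight b ⊕ on A

      Around : Sub (#V G) → Set
      Around R = R t ≡ true × Tight α D R

      around : ∃ (Violated α (D ⊕ at t)) → ∃ Around
      around (R , p , l) with R t in eq
      ...   | true  = R , eq , p , ≤-pred (≤-trans l (≤-reflexive (+-comm _ 1)))
      ...   | false = ⊥-elim (<⇒≱ l (≤-trans (≤-reflexive (+-identityʳ _)) (feasible st R p)))

      least : ∃[ R ] Minimal Around R
      least = let R , _ , mn = minimal (λ R → (R t 𝔹.≟ true) ×-dec tight? α D R)
                    (λ e (p , q) → trans (sym (e t)) p , tight-ext α D e q) (proj₁ (around viol)) (proj₂ (around viol))
              in R , mn

      R₀ : Sub (#V G)
      R₀ = proj₁ least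

      Near : V G → Set
      Near y = A y ≡ true × (R₀ y ≡ true ⊎ (∃[ e ] ((R₀ (src e true) ≡ true × dst e true ≡ y)
                                               ⊎ (R₀ (src e false) ≡ true × dst e false ≡ y))))

      near? : ∀ y → Dec (Near y)
      near? y = (A y 𝔹.≟ true) ×-dec ((R₀ y 𝔹.≟ true) ⊎-dec any? (λ e →
        ((R₀ (src e true) 𝔹.≟ true) ×-dec (dst e true ≟ᶠ y)) ⊎-dec
        ((R₀ (src e false) 𝔹.≟ true) ×-dec (dst e false ≟ᶠ y))))

      -- If no terminal of `A` were in or next to `R₀`, then forbidding transit through `A` would
      -- cost `R₀` no exit. Its exits would cover `k` units for each of its vertices in `T`, more
      -- than the current demand because `b t < k`, and `R₀` would not be tight.
      near : ∃ Near
      near with any? near?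
      ... | yes n = n
      ... | no ¬n = ⊥-elim (<⇒≱ below (begin
        k * amount (on T) R₀                         ≤⟨ full R₀ (proj₁ R₀-tight) ⟩
        out (avoid T) R₀                             ≤⟨ out-mono (avoid T) α R₀ clear ⟩
        out α R₀                                     ≤⟨ proj₂ R₀-tight ⟩
        amount (weight b) R₀ + amount (on A) R₀      ≡⟨ cong (amount (weight b) R₀ +_) none ⟩
        amount (weight b) R₀ + 0                     ≡⟨ +-identityʳ _ ⟩
        amount (weight b) R₀                         ∎))
        where
        open ≤-Reasoning
        t∈R₀ : R₀ t ≡ true
        t∈R₀ = proj₁ (proj₁ (proj₂ least))
        R₀-tight : Tight α D R₀
        R₀-tight = proj₂ (proj₁ (proj₂ least))
        none : amount (on A) R₀ ≡ 0
        none = trans (sum-cong-≗ (λ v → lem (A v) (R₀ v) (λ a r → ¬n (v , a , inj₁ r)))) (sum-zero (#V G))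
          where
          lem : ∀ a r → (a ≡ true → r ≡ true → ⊥) → b2n a * b2n r ≡ 0
          lem true  true  h = ⊥-elim (h refl refl)
          lem true  false h = refl
          lem false _     h = refl
        clear : ∀ e b → crosses R₀ e b ≡ true → avoid T e b ≡ true → α e b ≡ true
        clear e b cr h = cong not (∨-false (not⁻ h) (¬true λ a → ¬n (dst e b , a , inj₂ (e , side e b (proj₁ (∧⁻ cr))))))
          where
          side : ∀ e b → R₀ (src e b) ≡ true →
            (R₀ (src e true) ≡ true × dst e true ≡ dst e b) ⊎ (R₀ (src e false) ≡ true × dst e false ≡ dst e b)
          side e true  p = inj₁ (p , refl)
          side e false p = inj₂ (p , refl)
        below : amount (weight b) R₀ < k * amount (on T) R₀
        below = <-≤-trans (sum-mono-< (λ v → *-monoˡ-≤ (b2n (R₀ v)) (bound st v)) t lem) (≤-reflexive (k*sum R₀))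
          where
          lem : b t * b2n (R₀ t) < k * b2n (T t) * b2n (R₀ t)
          lem = subst₂ (λ r τ → b t * b2n r < k * b2n τ * b2n r) (sym t∈R₀) (sym Tt)
              (subst₂ _<_ (sym (*-identityʳ (b t))) (sym (trans (*-identityʳ (k * 1)) (*-identityʳ k))) bt)

      module _ (y : V G) (Ay : A y ≡ true)
               (adj : R₀ y ≡ true ⊎ (∃[ e ] ((R₀ (src e true) ≡ true × dst e true ≡ y)
                                             ⊎ (R₀ (src e false) ≡ true × dst e false ≡ y)))) where

        A′ : Sub (#V G)
        A′ = remove y A

        α′ : Arc
        α′ = avoid (T ∪ᵇ A′)

        α⊑α′ : ∀ e b → α e b ≡ true → α′ e b ≡ true
        α⊑α′ e b h = lem (T (dst e b)) (A (dst e b)) (dst e b == y) h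
          where
          lem : ∀ t a q → not (t ∨ a) ≡ true → not (t ∨ (a ∧ not q)) ≡ true
          lem false false q h = refl

        out≤out′ : ∀ R → out α R ≤ out α′ R
        out≤out′ R = out-mono α α′ R (λ e b _ → α⊑α′ e b)

        escape : ∀ R e b → R₀ ⊑ R → R y ≡ false → R₀ (src e b) ≡ true → dst e b ≡ y → out α R < out α′ R
        escape R e b R₀⊑R y∉R s refl = ∑ₐ-mono-< (λ e b → b2n-mono {α e b ∧ crosses R e b} λ p →
            let p₁ , p₂ = ∧⁻ {α e b} p in ∧⁺ (α⊑α′ e b p₁) p₂) e b
          (subst₂ (λ x z → b2n (x ∧ crosses R e b) < b2n (z ∧ crosses R e b)) (sym dead) (sym alive)
            (subst (λ z → 0 < b2n z) (sym (∧⁺ (R₀⊑R _ s) (cong not y∉R))) ≤-refl))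
          where
          dead : α e b ≡ false
          dead = cong not (∨ʳ {T (dst e b)} Ay)
          alive : α′ e b ≡ true
          alive = cong not (∨-false (disjoint st _ Ay) (∧-falseʳ {A (dst e b)} (cong not (==-refl (dst e b)))))

        -- The critical sets are tight, contain `t` and miss `y`. By minimality they contain `R₀`,
        -- so `y` is next to `R₀` and not in it, and an arc from `R₀` to `y`, available from now on,
        -- is the additional exit.
        feasible′ : ∀ R → R c ≡ false → amount D R + b2n (R t) ≤ out α′ R + b2n (R y)
        feasible′ R p with R t in Rt | R y in Ry
        ... | false | _     = +-mono-≤ (≤-trans (feasible st R p) (out≤out′ R)) z≤n
        ... | true  | true  = +-monoˡ-≤ 1 (≤-trans (feasible st R p) (out≤out′ R))
        ... | true  | false with out α R ≤? amount D R
        ...   | no ¬l = ≤-trans (≤-reflexive (+-comm _ 1)) (≤-trans (≰⇒> ¬l) (≤-trans (out≤out′ R) (≤-reflexive (sym (+-identityʳ _)))))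
        ...   | yes l = ≤-trans (≤-reflexive (+-comm _ 1)) (≤-trans (s≤s (feasible st R p))
                          (≤-trans (leaves adj) (≤-reflexive (sym (+-identityʳ _)))))
          where
          R₀⊑R : R₀ ⊑ R
          R₀⊑R i r = proj₂ (∧⁻ {R₀ i} (proj₂ (proj₂ least) {R₀ ∩ᵇ R} (λ _ q → proj₁ (∧⁻ q))
            (∧⁺ (proj₁ (proj₁ (proj₂ least))) Rt ,
             proj₂ (tight-∪∩ α D R₀ R (feasible st) (proj₂ (proj₁ (proj₂ least))) (p , l))) i r))
          leaves : _ → out α R < out α′ R
          leaves (inj₁ r) = contra (R₀⊑R y r) Ry
          leaves (inj₂ (e , inj₁ (s , d))) = escape R e true R₀⊑R Ry s d
          leaves (inj₂ (e , inj₂ (s , d))) = escape R e false R₀⊑R Ry s d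

        next : State (bump t b) A′
        next = record
          { bound = bound-bump st Tt bt
          ; within = λ i h → within st i (proj₁ (∧⁻ h))
          ; disjoint = λ i h → disjoint st i (proj₁ (∧⁻ h))
          ; lost = ≤-trans (lost st) (≤-reflexive (trans (cong (λ x → size T + x + sum b) (size-remove A y Ay))
                     (trans (eq (size T) (size A′) (sum b)) (cong (size T + size A′ +_) (sym (total-bump t b))))))
          ; feasible = λ R p → +-cancelʳ-≤ (b2n (R y)) _ _ (≤-trans (≤-reflexive
              (trans (cong (λ x → x + amount (on A′) R + b2n (R y)) (sum-bump t b (b2n ∘ R)))
              (trans (eq′ (amount (weight b) R) (b2n (R t)) (amount (on A′) R) (b2n (R y)))
                (cong (λ x → amount (weight b) R + x + b2n (R t)) (sym (on-remove A y Ay R))))))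
              (feasible′ R p)) }
          where
          eq : ∀ x a b → x + (a + 1) + b ≡ x + a + (b + 1)
          eq x a b = solve (x ∷ a ∷ b ∷ [])
          eq′ : ∀ w t a y → w + t + a + y ≡ w + (a + y) + t
          eq′ w t a y = solve (w ∷ t ∷ a ∷ y ∷ [])

    raise-all : ∀ m b A → State b A → k * size T ≤ m + sum b → Released
    raise-all m b A st h with any? (λ t → (T t 𝔹.≟ true) ×-dec (b t <? k))
    ... | no ¬t = finish st λ t Tt → ≮⇒≥ λ l → ¬t (t , Tt , l)
    ... | yes (t , Tt , bt) with feasible? (avoid (T ∪ᵇ A)) ((weight b ⊕ on A) ⊕ at t)
    raise-all zero b A st h | yes (t , Tt , bt) | _ = ⊥-elim (<⇒≱ (≤-trans (≤-reflexive (trans (+-comm 1 _) (sym (total-bump t b))))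
      (≤-trans (sum-mono (bound-bump st Tt bt)) (≤-reflexive (sum-*ˡ k (b2n ∘ T))))) h)
    raise-all (suc m) b A st h | yes (t , Tt , bt) | inj₁ F = raise-all m (bump t b) A (raise st Tt bt F) (less m b t h)
      where
      less : ∀ m b t → k * size T ≤ suc m + sum b → k * size T ≤ m + sum (bump t b)
      less m b t h = ≤-trans h (≤-reflexive (trans (sym (+-suc m (sum b))) (cong (m +_) (trans (+-comm 1 (sum b)) (sym (total-bump t b))))))
    raise-all (suc m) b A st h | yes (t , Tt , bt) | inj₂ viol =
      let y , Ay , adj = near in raise-all m (bump t b) (remove y A) (next y Ay adj)
        (≤-trans h (≤-reflexive (trans (sym (+-suc m (sum b))) (cong (m +_) (trans (+-comm 1 (sum b)) (sym (total-bump t b)))))))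
      where open Stuck st Tt bt viol

    released : Released
    released = raise-all (k * size T) (λ _ → 0) (S ∖ᵇ T) start (m≤m+n _ _)
      where
      start : State (λ _ → 0) (S ∖ᵇ T)
      start = record
        { bound = λ _ → z≤n
        ; within = λ i h → proj₁ (∧⁻ h)
        ; disjoint = λ i h → not⁻ (proj₂ (∧⁻ {S i} h))
        ; lost = ≤-trans (≤-trans (sum-mono (λ v → lem (S v) (T v))) (≤-reflexive (∑-distrib-+ (b2n ∘ T) _))) (m≤m+n _ _)
        ; feasible = λ R p → ≤-trans (+-mono-≤ (≤-reflexive (sum-zero (#V G)))
            (sum-mono (λ v → *-monoˡ-≤ (b2n (R v)) (b2n-mono {S v ∧ not (T v)} {S v} (λ h → proj₁ (∧⁻ {S v} {not (T v)} h))))))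
            (≤-trans (star R p) (out-mono (avoid S) (avoid (T ∪ᵇ (S ∖ᵇ T))) R λ e b _ h →
              cong not (¬true (λ q → contra ([ T⊑S (dst e b) , (λ r → proj₁ (∧⁻ r)) ]′ (∨⁻ {T (dst e b)} q)) (not⁻ h))))) }
        where
        lem : ∀ s t → b2n s ≤ b2n t + b2n (s ∧ not t)
        lem = toWitness {a? = all𝔹 λ s → all𝔹 λ t → _ ≤? _} _

-- Absorbing the remaining terminals into a closed set of small slack.

module Absorb (G : Graph) (c : V G) (k₁ : ℕ) (T A : Sub (#V G)) (M : Sub (#E G)) (Δ : ℕ) where

  open Release G c
  open Sparsify G c A (suc k₁) using (cut)

  k : ℕ
  k = suc k₁

  -- `g` is the slack left by the demand of `T`; the truncated subtraction is exact on sets avoiding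
  -- `c`, as `o≡` shows.
  o τ g : Sub (#V G) → ℕ
  o = out (avoid T)
  τ = amount (k · on T)
  g R = o R ∸ τ R

  -- The part of the bound on `μ` that does not depend on `U`: the vertices of `T`, the exits of `U`
  -- owed to at most `k` units from each of them, and the ends of `M` at `T`.
  q : ℕ
  q = size T + k * size T + Δ

  module _ (conn : ∀ R → R c ≡ false → ∀ x → A x ≡ true → R x ≡ true → k ≤ cut M R)
           (degree : ∑ₐ (λ e b → b2n (M e ∧ T (src e b))) ≤ Δ)
           (feasible : Feasible (avoid (T ∪ᵇ A)) (k · on T ⊕ on A))
           (stuck : ∀ x → A x ≡ true → ∃[ R ] (R c ≡ false × R x ≡ true × o R < τ R + k)) where

    -- This makes slack an upper bound for the number of vertices of `A` in a set, which is how
    -- `bounded` counts them.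
    τ+on≤o : ∀ R → R c ≡ false → τ R + amount (on A) R ≤ o R
    τ+on≤o R p = ≤-trans (feasible R p) (out-mono (avoid (T ∪ᵇ A)) (avoid T) R
      λ e b _ → lem (T (dst e b)) (A (dst e b)))
      where
      lem : ∀ t a → not (t ∨ a) ≡ true → not t ≡ true
      lem false _ _ = refl

    o≡ : ∀ R → R c ≡ false → o R ≡ g R + τ R
    o≡ R p = sym (m∸n+n≡m {o R} {τ R} (≤-trans (m≤m+n (τ R) (amount (on A) R)) (τ+on≤o R p)))

    g-ext : ∀ {R R′} → R ≗ R′ → g R ≡ g R′
    g-ext e = cong₂ _∸_ (out-ext (avoid T) e) (ext (k · on T) e)

    g-submod : ∀ R R′ → R c ≡ false → R′ c ≡ false → g (R ∪ᵇ R′) + g (R ∩ᵇ R′) ≤ g R + g R′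
    g-submod R R′ p p′ = lem (g (R ∪ᵇ R′)) (g (R ∩ᵇ R′)) (g R) (g R′) (τ (R ∪ᵇ R′)) (τ (R ∩ᵇ R′)) (τ R) (τ R′)
      (modular (k · on T) R R′)
      (subst₂ _≤_ (cong₂ _+_ (o≡ (R ∪ᵇ R′) (∨-false p p′)) (o≡ (R ∩ᵇ R′) (∧-falseˡ p))) (cong₂ _+_ (o≡ R p) (o≡ R′ p′))
        (out-submod (avoid T) R R′))
      where
      lem : ∀ a b c d e f g h → e + f ≡ g + h → (a + e) + (b + f) ≤ (c + g) + (d + h) → a + b ≤ c + d
      lem a b c d e f g h eq l = +-cancelʳ-≤ (e + f) _ _ (subst₂ _≤_ (+-interchange a e b f)
        (trans (+-interchange c g d h) (cong (c + d +_) (sym eq))) l)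

    -- Proper supersets avoiding `c` have strictly larger slack; this strictness yields the unit
    -- saved in each round.
    Closed : Sub (#V G) → Set
    Closed U = ∀ {W} → U ⊑ W → W c ≡ false → g W ≤ g U → W ⊑ U

    -- Uniting `U` with `R` costs less than `k - i` units of slack. For `i = k` the slack would
    -- fall, so a closed `U` then contains all of `A`.
    Reach : ℕ → Sub (#V G) → Set
    Reach i U = ∀ x → A x ≡ true → U x ≡ false →
      ∃[ R ] (R c ≡ false × R x ≡ true × g (U ∪ᵇ R) + i < g U + k)

    -- The bound is kept for `g U + q` instead of `g U`, because a round multiplies it by exactly
    -- `k`.
    record Stage (i s : ℕ) : Set where
      field
        U      : Sub (#V G)
        c∉U    : U c ≡ false
        small  : g U + q ≤ s
        sealed : Closed U
        reach  : Reach i U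

    g-stuck : ∀ R → R c ≡ false → o R < τ R + k → g R < k
    g-stuck R p l = +-cancelʳ-< (τ R) (g R) k (subst₂ _<_ (o≡ R p) (+-comm (τ R) k) l)

    -- A maximal set of slack `0` is closed, and by submodularity uniting it with a set of slack
    -- below `k` costs less than `k`.
    initial : Stage 0 q
    initial = record
      { U = U ; c∉U = c∉U ; small = +-monoˡ-≤ q gU≤0
      ; sealed = λ U⊑W p l → mx U⊑W (p , ≤-trans l gU≤0)
      ; reach = λ x Ax _ → let R , p , Rx , l = stuck x Ax in R , p , Rx ,
          ≤-<-trans (≤-reflexive (+-identityʳ _)) (≤-<-trans (≤-trans (m≤m+n _ _) (g-submod U R c∉U p))
            (+-monoʳ-< (g U) (g-stuck R p l))) }
      where
      spec : ∃[ U ] (∅ᵇ ⊑ U × Maximal (λ U → U c ≡ false × g U ≤ 0) U)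
      spec = maximal (λ U → (U c 𝔹.≟ false) ×-dec (g U ≤? 0))
        (λ e (p , l) → trans (sym (e c)) p , subst (_≤ 0) (g-ext e) l) ∅ᵇ
        (refl , ≤-trans (m∸n≤m (o ∅ᵇ) (τ ∅ᵇ)) (≤-reflexive (out-∅ (avoid T))))
      U : Sub (#V G)
      U = proj₁ spec
      c∉U : U c ≡ false
      c∉U = proj₁ (proj₁ (proj₂ (proj₂ spec)))
      gU≤0 : g U ≤ 0
      gU≤0 = proj₂ (proj₁ (proj₂ (proj₂ spec)))
      mx : ∀ {W} → U ⊑ W → W c ≡ false × g W ≤ 0 → W ⊑ U
      mx = proj₂ (proj₂ (proj₂ spec))

    module Grow (i s : ℕ) (st : Stage i s) where

      open Stage st

      -- Arcs from `U` are counted only when they end outside `T`, so that there are at most `o U`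
      -- of them; arcs from `T` only when they lie in `M`, so that there are at most `Δ`.
      enters : Sub (#V G) → Arc
      enters W e b = ((U (src e b) ∧ not (T (dst e b))) ∨ (M e ∧ T (src e b))) ∧ (W (dst e b) ∧ not (U (dst e b)))

      fresh : Sub (#V G) → Sub (#V G)
      fresh W v = T v ∧ (W v ∧ not (U v))

      -- Bounds the number of disjoint sets outside U that a set W ⊇ U has swallowed: each of
      -- them contains a vertex of T or receives an edge from U or T.
      μ : Sub (#V G) → ℕ
      μ W = size (fresh W) + ∑ₐ (λ e b → b2n (enters W e b))

      fresh-mono : ∀ {W W′} → W ⊑ W′ → fresh W ⊑ fresh W′
      fresh-mono {W} h v p = let t , r = ∧⁻ {T v} p ; w , u = ∧⁻ {W v} r in ∧⁺ t (∧⁺ (h v w) u)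

      enters-mono : ∀ {W W′} → W ⊑ W′ → ∀ e b → enters W e b ≡ true → enters W′ e b ≡ true
      enters-mono {W} h e b p =
        let t , r = ∧⁻ {(U (src e b) ∧ not (T (dst e b))) ∨ (M e ∧ T (src e b))} p
            w , u = ∧⁻ {W (dst e b)} r
        in ∧⁺ t (∧⁺ (h (dst e b) w) u)

      μ-mono : ∀ {W W′} → W ⊑ W′ → μ W ≤ μ W′
      μ-mono {W} {W′} h = +-mono-≤ (size-mono (fresh-mono h)) (∑ₐ-mono (λ e b → b2n-mono {enters W e b} {enters W′ e b} (enters-mono h e b)))

      μ-ext : ∀ {W W′} → W ≗ W′ → μ W ≡ μ W′
      μ-ext {W} {W′} h = cong₂ _+_ (size-cong (λ v → cong (λ x → T v ∧ (x ∧ not (U v))) (h v)))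
        (∑ₐ-cong (λ e b → cong (λ x → b2n (((U (src e b) ∧ not (T (dst e b))) ∨ (M e ∧ T (src e b))) ∧ (x ∧ not (U (dst e b))))) (h (dst e b))))

      μ≤ : ∀ W → μ W ≤ g U + q
      μ≤ W = begin
        size (fresh W) + ∑ₐ (λ e b → b2n (enters W e b))
          ≤⟨ +-mono-≤ (size-mono (λ v p → proj₁ (∧⁻ {T v} p)))
               (∑ₐ-mono (λ e b → lem (U (src e b)) (T (dst e b)) (M e) (T (src e b)) (W (dst e b)) (U (dst e b)))) ⟩
        size T + ∑ₐ (λ e b → b2n (not (T (dst e b)) ∧ crosses U e b) + b2n (M e ∧ T (src e b)))
          ≡⟨ cong (size T +_) (∑ₐ-+ _ _) ⟩
        size T + (o U + ∑ₐ (λ e b → b2n (M e ∧ T (src e b))))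
          ≤⟨ +-monoʳ-≤ (size T) (+-mono-≤ (≤-trans (≤-reflexive (o≡ U c∉U)) (+-monoʳ-≤ (g U) τ≤)) degree) ⟩
        size T + (g U + k * size T + Δ)
          ≡⟨ eq (size T) (g U) (k * size T) Δ ⟩
        g U + q ∎
        where
        open ≤-Reasoning
        lem : ∀ us td m ts w ud → b2n (((us ∧ not td) ∨ (m ∧ ts)) ∧ (w ∧ not ud)) ≤ b2n (not td ∧ (us ∧ not ud)) + b2n (m ∧ ts)
        lem = toWitness {a? = all𝔹 λ us → all𝔹 λ td → all𝔹 λ m → all𝔹 λ ts → all𝔹 λ w → all𝔹 λ ud → _ ≤? _} _
        eq : ∀ a b c d → a + (b + c + d) ≡ b + (a + c + d)
        eq a b c d = solve (a ∷ b ∷ c ∷ d ∷ [])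
        τ≤ : τ U ≤ k * size T
        τ≤ = *-monoʳ-≤ k (≤-trans (mono (on T) {U} {λ _ → true} (λ _ _ → refl)) (≤-reflexive (sym (sum-*1 (b2n ∘ T)))))

      -- A maximal set of this kind replaces the successive addition of disjoint sets: each addition
      -- costs at most `k₁` units of slack and raises `μ` by at least one.
      Absorbing : Sub (#V G) → Set
      Absorbing W = U ⊑ W × W c ≡ false × g W ≤ g U + k₁ * μ W

      spec : ∃[ W ] (U ⊑ W × Maximal Absorbing W)
      spec = maximal (λ W → (U ⊑? W) ×-dec (W c 𝔹.≟ false) ×-dec (g W ≤? g U + k₁ * μ W))
        (λ e (h , p , l) → (λ v u → trans (sym (e v)) (h v u)) , trans (sym (e c)) p ,
          subst₂ (λ x y → x ≤ g U + k₁ * y) (g-ext e) (μ-ext e) l)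
        U ((λ _ u → u) , c∉U , m≤m+n _ _)

      module _ (W : Sub (#V G)) (U⊑W : U ⊑ W) (c∉W : W c ≡ false) (gW : g W ≤ g U + k₁ * μ W)
               (mx : ∀ {W′} → W ⊑ W′ → Absorbing W′ → W′ ⊑ W) where

        small′ : g W + q ≤ k * s
        small′ = begin
          g W + q                          ≤⟨ +-monoˡ-≤ q gW ⟩
          g U + k₁ * μ W + q               ≤⟨ +-monoˡ-≤ q (+-monoʳ-≤ (g U) (*-monoʳ-≤ k₁ (μ≤ W))) ⟩
          g U + k₁ * (g U + q) + q         ≡⟨ eq (g U) (k₁ * (g U + q)) q ⟩
          k * (g U + q)                    ≤⟨ *-monoʳ-≤ k small ⟩
          k * s                            ∎
          where
          open ≤-Reasoning
          eq : ∀ a b c → a + b + c ≡ a + c + b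
          eq a b c = solve (a ∷ b ∷ c ∷ [])

        -- `μ` is monotone, so a superset avoiding `c` with no more slack is again `Absorbing`.
        sealed′ : Closed W
        sealed′ {W′} W⊑W′ p l = mx W⊑W′ ((λ v → W⊑W′ v ∘ U⊑W v) , p ,
          ≤-trans l (≤-trans gW (+-monoʳ-≤ (g U) (*-monoʳ-≤ k₁ (μ-mono W⊑W′)))))

        module _ (R : Sub (#V G)) (c∉R : R c ≡ false) (l : g (U ∪ᵇ R) + i < g U + k) where

          c∉UR : (U ∪ᵇ R) c ≡ false
          c∉UR = ∨-false c∉U c∉R

          joint : g (W ∪ᵇ R) + g (W ∩ᵇ (U ∪ᵇ R)) ≤ g W + g (U ∪ᵇ R)
          joint = subst (λ x → x + g (W ∩ᵇ (U ∪ᵇ R)) ≤ g W + g (U ∪ᵇ R))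
            (g-ext (λ v → lem (W v) (U v) (R v) (U⊑W v))) (g-submod W (U ∪ᵇ R) c∉W c∉UR)
            where
            lem : ∀ w u r → (u ≡ true → w ≡ true) → w ∨ (u ∨ r) ≡ w ∨ r
            lem true  u     r h = refl
            lem false false r h = refl
            lem false true  r h with h refl
            ... | ()

          -- `W ∩ᵇ (U ∪ᵇ R)` properly contains the closed set `U` and has more slack; submodularity
          -- passes this unit on to `W ∪ᵇ R`.
          overlapping : ∀ v → W v ≡ true → R v ≡ true → U v ≡ false → g (W ∪ᵇ R) + suc i < g W + k
          overlapping v Wv Rv Uv = lem (g (W ∪ᵇ R)) (g (W ∩ᵇ (U ∪ᵇ R))) (g W) (g (U ∪ᵇ R)) (g U) joint grows l
            where
            grows : suc (g U) ≤ g (W ∩ᵇ (U ∪ᵇ R))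
            grows = ≰⇒> λ le → contra (sealed {W ∩ᵇ (U ∪ᵇ R)} (λ j u → ∧⁺ (U⊑W j u) (∨ˡ u)) (∧-falseˡ c∉W) le v
              (∧⁺ Wv (∨ʳ {U v} Rv))) Uv
            lem : ∀ a b c d e → a + b ≤ c + d → suc e ≤ b → d + i < e + k → a + suc i < c + k
            lem a b c d e h₁ h₂ h₃ = linear 0 (+-mono-≤ (+-mono-≤ h₁ h₂) h₃) (eq a b c d e i k)
              where
              eq : ∀ a b c d e i k → suc (a + suc i) + (c + d + b + (e + k)) + 0 ≡ c + k + (a + b + suc e + suc (d + i))
              eq a b c d e i k = solve (a ∷ b ∷ c ∷ d ∷ e ∷ i ∷ k ∷ [])

          module _ (apart : ∀ v → W v ≡ true → R v ≡ true → U v ≡ true) where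

            -- Here `W ∩ᵇ (U ∪ᵇ R)` is `U` itself, so adding `R` costs `W` no more than it costs
            -- `U`.
            gWR : g (W ∪ᵇ R) ≤ g W + k₁
            gWR = lem (g (W ∪ᵇ R)) (g U) (g W) (g (U ∪ᵇ R))
              (subst (λ x → g (W ∪ᵇ R) + x ≤ g W + g (U ∪ᵇ R)) (g-ext meet) joint) l
              where
              meet : W ∩ᵇ (U ∪ᵇ R) ≗ U
              meet = ⊑-antisym (λ v p → let w , ur = ∧⁻ {W v} p in [ (λ u → u) , apart v w ]′ (∨⁻ {U v} ur))
                               (λ v u → ∧⁺ (U⊑W v u) (∨ˡ u))
              lem : ∀ a e c d → a + e ≤ c + d → d + i < e + k → a ≤ c + k₁
              lem a e c d h₁ h₂ = linear i (+-mono-≤ h₁ h₂) (eq a e c d i k₁)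
                where
                eq : ∀ a e c d i k₁ → a + (c + d + (e + suc k₁)) + i ≡ c + k₁ + (a + e + suc (d + i))
                eq a e c d i k₁ = solve (a ∷ e ∷ c ∷ d ∷ i ∷ k₁ ∷ [])

            module _ (x : V G) (Ax : A x ≡ true) (Rx : R x ≡ true) (Ux : U x ≡ false) where

              -- Otherwise all the edges of M around R ∖ U count towards the cut of U ∪ R.
              isolated : (∀ v → fresh R v ≡ false) → (∀ e b → enters R e b ≡ false) → g U + k ≤ g (U ∪ᵇ R)
              isolated noT noE = lem (o U) (cut M (R ∖ᵇ U)) (o (U ∪ᵇ R)) (g U) (τ U) (g (U ∪ᵇ R)) (τ (U ∪ᵇ R))
                  (subst (_≤ o (U ∪ᵇ R)) (∑ₐ-+ _ _) (∑ₐ-mono per-arc))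
                  (conn (R ∖ᵇ U) (∧-falseˡ c∉R) x Ax (∧⁺ Rx (cong not Ux)))
                  (o≡ U c∉U) (o≡ (U ∪ᵇ R) c∉UR) (*-monoʳ-≤ k (sum-mono (λ v → τ-lem (T v) (U v) (R v) (noT v))))
                where
                τ-lem : ∀ t u r → t ∧ (r ∧ not u) ≡ false → b2n t * b2n (u ∨ r) ≤ b2n t * b2n u
                τ-lem false u     r     _ = z≤n
                τ-lem true  true  r     _ = ≤-refl
                τ-lem true  false false _ = ≤-refl
                -- An arc of `M` leaving `R ∖ᵇ U` ends neither in `U` nor in `T`, since its reverse
                -- would be an entering arc or its source a fresh vertex; so it is an exit of
                -- `U ∪ᵇ R`. Likewise no exit of `U` is lost to `R`.
                arc-lem : ∀ m us ud ts td rs rd →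
                  ((us ∧ not td) ∨ (m ∧ ts)) ∧ (rd ∧ not ud) ≡ false →
                  ((ud ∧ not ts) ∨ (m ∧ td)) ∧ (rs ∧ not us) ≡ false →
                  ts ∧ (rs ∧ not us) ≡ false →
                  b2n (not td ∧ (us ∧ not ud)) + b2n (m ∧ ((rs ∧ not us) ∧ not (rd ∧ not ud))) ≤ b2n (not td ∧ ((us ∨ rs) ∧ not (ud ∨ rd)))
                arc-lem = toWitness {a? = all𝔹 λ m → all𝔹 λ us → all𝔹 λ ud → all𝔹 λ ts → all𝔹 λ td → all𝔹 λ rs → all𝔹 λ rd →
                  (_ 𝔹.≟ _) →-dec (_ 𝔹.≟ _) →-dec (_ 𝔹.≟ _) →-dec (_ ≤? _)} _
                per-arc : ∀ e b → _
                per-arc e true  = arc-lem (M e) (U (end₁ G e)) (U (end₂ G e)) (T (end₁ G e)) (T (end₂ G e)) (R (end₁ G e)) (R (end₂ G e))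
                  (noE e true) (noE e false) (noT (end₁ G e))
                per-arc e false = arc-lem (M e) (U (end₂ G e)) (U (end₁ G e)) (T (end₂ G e)) (T (end₁ G e)) (R (end₂ G e)) (R (end₁ G e))
                  (noE e false) (noE e true) (noT (end₂ G e))
                lem : ∀ a b c d e f h → a + b ≤ c → k ≤ b → a ≡ d + e → c ≡ f + h → h ≤ e → d + k ≤ f
                lem a b c d e f h h₁ h₂ refl refl h₃ = linear 0 (+-mono-≤ (+-mono-≤ h₁ h₂) h₃) (eq b d e f h k)
                  where
                  eq : ∀ b d e f h k → d + k + (f + h + b + e) + 0 ≡ f + (d + e + b + k + h)
                  eq b d e f h k = solve (b ∷ d ∷ e ∷ f ∷ h ∷ k ∷ [])

              outside : ∀ v → R v ≡ true → U v ≡ false → W v ≡ false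
              outside v Rv Uv = ¬true λ Wv → contra (apart v Wv Rv) Uv

              μ< : μ W < μ (W ∪ᵇ R)
              μ< with any? (λ v → fresh R v 𝔹.≟ true)
              ... | yes (v , p) = +-mono-<-≤ (size-mono-< {A = fresh W} {fresh (W ∪ᵇ R)} (fresh-mono {W} {W ∪ᵇ R} (λ _ → ∨ˡ)) v
                      (trans (cong (λ x → T v ∧ (x ∧ not (U v))) (outside v (proj₁ pr) (not⁻ (proj₂ pr)))) (𝔹.∧-zeroʳ (T v)))
                      (fresh-mono {R} {W ∪ᵇ R} (λ j → ∨ʳ {W j}) v p))
                    (∑ₐ-mono (λ e b → b2n-mono {enters W e b} {enters (W ∪ᵇ R) e b} (enters-mono {W} {W ∪ᵇ R} (λ _ → ∨ˡ) e b)))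
                where
                pr : R v ≡ true × not (U v) ≡ true
                pr = ∧⁻ {R v} (proj₂ (∧⁻ {T v} p))
              ... | no ¬T with any? (λ e → (enters R e true 𝔹.≟ true) ⊎-dec (enters R e false 𝔹.≟ true))
              ...   | yes (e , h) = [ new e true , new e false ]′ h
                where
                new : ∀ e b → enters R e b ≡ true → μ W < μ (W ∪ᵇ R)
                new e b p = +-mono-≤-< (size-mono {A = fresh W} {fresh (W ∪ᵇ R)} (fresh-mono {W} {W ∪ᵇ R} (λ _ → ∨ˡ)))
                  (∑ₐ-mono-< (λ e b → b2n-mono {enters W e b} {enters (W ∪ᵇ R) e b} (enters-mono {W} {W ∪ᵇ R} (λ _ → ∨ˡ) e b)) e b
                    (subst₂ (λ x y → b2n x < b2n y) (sym off) (sym (enters-mono {R} {W ∪ᵇ R} (λ j → ∨ʳ {W j}) e b p)) ≤-refl))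
                  where
                  pr : R (dst e b) ≡ true × not (U (dst e b)) ≡ true
                  pr = ∧⁻ {R (dst e b)} (proj₂ (∧⁻ {(U (src e b) ∧ not (T (dst e b))) ∨ (M e ∧ T (src e b))} p))
                  off : enters W e b ≡ false
                  off = ∧-falseʳ {(U (src e b) ∧ not (T (dst e b))) ∨ (M e ∧ T (src e b))}
                    (∧-falseˡ (outside (dst e b) (proj₁ pr) (not⁻ (proj₂ pr))))
              ...   | no ¬E = ⊥-elim (<⇒≱ (≤-<-trans (m≤m+n _ _) l) (isolated (λ v → ¬true λ p → ¬T (v , p))
                      λ { e true → ¬true λ p → ¬E (e , inj₁ p) ; e false → ¬true λ p → ¬E (e , inj₂ p) }))

              swallowed : W x ≡ true
              swallowed = mx {W ∪ᵇ R} (λ _ → ∨ˡ) ((λ v u → ∨ˡ (U⊑W v u)) , ∨-false c∉W c∉R , grown) x (∨ʳ {W x} Rx)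
                where
                open ≤-Reasoning
                grown : g (W ∪ᵇ R) ≤ g U + k₁ * μ (W ∪ᵇ R)
                grown = begin
                  g (W ∪ᵇ R)               ≤⟨ gWR ⟩
                  g W + k₁                 ≤⟨ +-monoˡ-≤ k₁ gW ⟩
                  g U + k₁ * μ W + k₁      ≡⟨ eq (g U) k₁ (μ W) ⟩
                  g U + k₁ * suc (μ W)     ≤⟨ +-monoʳ-≤ (g U) (*-monoʳ-≤ k₁ μ<) ⟩
                  g U + k₁ * μ (W ∪ᵇ R)    ∎
                  where
                  eq : ∀ a b c → a + b * c + b ≡ a + b * suc c
                  eq a b c = solve (a ∷ b ∷ c ∷ [])

        reach′ : Reach (suc i) W
        reach′ x Ax Wx with reach x Ax (¬true λ u → contra (U⊑W x u) Wx)
        ... | R , c∉R , Rx , l with any? (λ v → (W v 𝔹.≟ true) ×-dec (R v 𝔹.≟ true) ×-dec (U v 𝔹.≟ false))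
        ...   | yes (v , w , r , u) = R , c∉R , Rx , overlapping R c∉R l v w r u
        ...   | no ¬v = contra (swallowed R c∉R l (λ v w r → [ (λ u → u) , (λ u → ⊥-elim (¬v (v , w , r , u))) ]′ (decide (U v)))
                                 x Ax Rx (¬true λ u → contra (U⊑W x u) Wx)) Wx
          where
          decide : ∀ b → b ≡ true ⊎ b ≡ false
          decide true  = inj₁ refl
          decide false = inj₂ refl

      grow : Stage (suc i) (k * s)
      grow = let W , U⊑W , (_ , c∉W , gW) , mx = spec in record
        { U = W ; c∉U = c∉W ; small = small′ W U⊑W c∉W gW mx
        ; sealed = sealed′ W U⊑W c∉W gW mx ; reach = reach′ W U⊑W c∉W gW mx }

    stage : ∀ i → Stage i (k ^ i * q)
    stage zero    = subst (Stage 0) (sym (+-identityʳ q)) initial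
    stage (suc i) = subst (Stage (suc i)) (sym (*-assoc k (k ^ i) q)) (Grow.grow i (k ^ i * q) (stage i))

    bounded : size A ≤ k ^ k * q
    bounded = begin
      size A                     ≡⟨ sum-*1 (b2n ∘ A) ⟩
      sum (λ v → b2n (A v) * 1)  ≤⟨ sum-mono (λ v → lem (A v) (U v) (A⊑U v)) ⟩
      amount (on A) U            ≤⟨ +-cancelˡ-≤ (τ U) _ _ (≤-trans (τ+on≤o U c∉U) (≤-reflexive (trans (o≡ U c∉U) (+-comm (g U) _)))) ⟩
      g U                        ≤⟨ m≤m+n (g U) q ⟩
      g U + q                    ≤⟨ small ⟩
      k ^ k * q                  ∎
      where
      open ≤-Reasoning
      open Stage (stage k)
      lem : ∀ a u → (a ≡ true → u ≡ true) → b2n a * 1 ≤ b2n a * b2n u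
      lem false u h = z≤n
      lem true  u h rewrite h refl = ≤-refl
      A⊑U : A ⊑ U
      A⊑U x Ax with U x in eq
      ... | true  = refl
      ... | false = let R , c∉R , Rx , l = reach x Ax eq in
        contra (sealed {U ∪ᵇ R} (λ _ → ∨ˡ) (∨-false c∉U c∉R) (<⇒≤ (+-cancelʳ-< k _ _ l)) x (∨ʳ {U x} Rx)) eq

-- Selecting terminals that can each send `k` units.

module Select (G : Graph) (c : V G) (k₁ : ℕ) (S : Sub (#V G)) where

  open Release G c

  k : ℕ
  k = suc k₁

  feasible-dec : ∀ α D → Dec (Feasible α D)
  feasible-dec α D with feasible? α D
  ... | inj₁ F = yes F
  ... | inj₂ (R , p , l) = no λ F → <⇒≱ l (F R p)

  avoid-mono : ∀ {W W′} → W′ ⊑ W → ∀ R → out (avoid W) R ≤ out (avoid W′) R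
  avoid-mono {W} {W′} h R = out-mono (avoid W) (avoid W′) R λ e b _ p → cong not (¬true λ q → contra (h _ q) (not⁻ p))

  on-mono : ∀ {W W′ : Sub (#V G)} → W ⊑ W′ → ∀ R → amount (on W) R ≤ amount (on W′) R
  on-mono h R = sum-mono (λ v → *-monoˡ-≤ (b2n (R v)) (b2n-mono (h v)))

  Full : Sub (#V G) → Set
  Full T = Feasible (avoid T) (k · on T)

  module _ (M : Sub (#E G)) where

    degreeIn : V G → ℕ
    degreeIn x = ∑ₐ (λ e b → b2n (M e ∧ (x == src e b)))

    degree-fibres : ∀ (S : Sub (#V G)) → ∑ₐ (λ e b → b2n (M e ∧ S (src e b))) ≡ sum (λ x → if S x then degreeIn x else 0)
    degree-fibres S = trans (∑ₐ-cong λ e b → sym (sum-δ (λ x → b2n (M e ∧ S x)) (src e b)))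
      (trans (∑ₐ-sum {#V G} (λ x e b → if x == src e b then b2n (M e ∧ S x) else 0)) (sum-cong-≗ λ x → fibre x (S x)))
      where
      fibre : ∀ x s → ∑ₐ (λ e b → if x == src e b then b2n (M e ∧ s) else 0) ≡ (if s then degreeIn x else 0)
      fibre x true  = ∑ₐ-cong λ e b → lem (x == src e b) (M e)
        where
        lem : ∀ q m → (if q then b2n (m ∧ true) else 0) ≡ b2n (m ∧ q)
        lem = toWitness {a? = all𝔹 λ q → all𝔹 λ m → _ ≟ⁿ _} _
      fibre x false = trans (∑ₐ-cong λ e b → lem (x == src e b) (M e)) (trans (∑ₐ-def (λ _ _ → 0)) (sum-zero (#E G)))
        where
        lem : ∀ q m → (if q then b2n (m ∧ false) else 0) ≡ 0
        lem = toWitness {a? = all𝔹 λ q → all𝔹 λ m → _ ≟ⁿ _} _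

    -- The threshold is twice the average bound `2 * k` from sparsification, so by Markov's
    -- inequality at least half of `S` passes it.
    low : Sub (#V G)
    low x = S x ∧ does (degreeIn x ≤? 4 * k)

    low⇒≤ : ∀ x → low x ≡ true → degreeIn x ≤ 4 * k
    low⇒≤ x h = does⇒ (degreeIn x ≤? 4 * k) (proj₂ (∧⁻ {S x} h))

    half-low : ∑ₐ (λ e b → b2n (M e ∧ S (src e b))) ≤ 2 * k * size S → size S ≤ 2 * size low
    half-low h = lem (size S) (size low) (size high) total
      (*-cancelˡ-≤ (2 * k) (≤-trans (≤-reflexive (eq k (size high))) (≤-trans markov h)))
      where
      high : Sub (#V G)
      high x = S x ∧ not (does (degreeIn x ≤? 4 * k))
      total : size S ≡ size low + size high
      total = trans (sum-cong-≗ λ x → split (S x) (does (degreeIn x ≤? 4 * k))) (∑-distrib-+ (b2n ∘ low) _)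
        where
        split : ∀ s d → b2n s ≡ b2n (s ∧ d) + b2n (s ∧ not d)
        split = toWitness {a? = all𝔹 λ s → all𝔹 λ d → _ ≟ⁿ _} _
      markov : 4 * k * size high ≤ ∑ₐ (λ e b → b2n (M e ∧ S (src e b)))
      markov = ≤-trans (≤-reflexive (sym (sum-*ˡ (4 * k) (b2n ∘ high))))
        (≤-trans (sum-mono term) (≤-reflexive (sym (degree-fibres S))))
        where
        weigh : ∀ s {a n} (p? : Dec (a ≤ n)) → n * b2n (s ∧ not (does p?)) ≤ (if s then a else 0)
        weigh false {n = n} _       = ≤-reflexive (*-zeroʳ n)
        weigh true  {n = n} (yes _) = ≤-trans (≤-reflexive (*-zeroʳ n)) z≤n
        weigh true  {n = n} (no ¬p) = ≤-trans (≤-reflexive (*-identityʳ n)) (<⇒≤ (≰⇒> ¬p))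
        term : ∀ x → 4 * k * b2n (high x) ≤ (if S x then degreeIn x else 0)
        term x = weigh (S x) (degreeIn x ≤? 4 * k)
      eq : ∀ k h → 2 * k * (2 * h) ≡ 4 * k * h
      eq k h = solve (k ∷ h ∷ [])
      lem : ∀ s l h → s ≡ l + h → 2 * h ≤ s → s ≤ 2 * l
      lem s l h refl le = linear 0 le (solve (l ∷ h ∷ []))

  on-insert : ∀ x (T : Sub (#V G)) → T x ≡ false → ∀ R → amount (on (insert x T)) R ≡ amount (on T) R + b2n (R x)
  on-insert x T Tx R = trans (on-remove (insert x T) x (∨ʳ {T x} (==-refl x)) R)
    (cong (_+ b2n (R x)) (sum-cong-≗ λ v → cong (λ y → b2n y * b2n (R v)) (back v)))
    where
    back : remove x (insert x T) ≗ T
    back v with v ≟ᶠ x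
    ... | yes refl = trans (𝔹.∧-zeroʳ (T v ∨ true)) (sym Tx)
    ... | no _     = trans (𝔹.∧-identityʳ (T v ∨ false)) (𝔹.∨-identityʳ (T v))

  select : Feasible (avoid S) (on S) → Sparsify.Connects G c S k (λ _ → true) →
    ∃[ T ] (T ⊑ S × Full T ×
      size S ≤ 2 * (size T + k ^ k * (size T + k * size T + 4 * k * size T) + k * size T))
  select star conn with Sparsify.sparsify G c S k conn
  ... | M , connM , deg = found spec
    where
    S₀ : Sub (#V G)
    S₀ = low M
    S₀⊑S : S₀ ⊑ S
    S₀⊑S x h = proj₁ (∧⁻ {S x} h)
    star₀ : Feasible (avoid S₀) (on S₀)
    star₀ R p = ≤-trans (on-mono S₀⊑S R) (≤-trans (star R p) (avoid-mono S₀⊑S R))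
    Candidate : Sub (#V G) → Set
    Candidate T = T ⊑ S₀ × Full T
    spec : ∃[ T ] (∅ᵇ ⊑ T × Maximal Candidate T)
    spec = maximal (λ T → (T ⊑? S₀) ×-dec feasible-dec (avoid T) (k · on T))
      (λ {T} {T′} e (h , F) → (λ v t → h v (trans (e v) t)) ,
        λ R p → ≤-trans (*-monoʳ-≤ k (on-mono {T′} {T} (λ v t → trans (e v) t) R))
          (≤-trans (F R p) (avoid-mono {T} {T′} (λ v t → trans (e v) t) R)))
      ∅ᵇ ((λ _ ()) , λ R p → ≤-trans (≤-reflexive (trans (cong (k *_) (sum-zero (#V G))) (*-zeroʳ k))) z≤n)
    found : ∃[ T ] (∅ᵇ ⊑ T × Maximal Candidate T) → _
    found (T , _ , (T⊑S₀ , F) , mx) with Release.released G c k S₀ T T⊑S₀ star₀ F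
    ... | A , A⊑S₀ , dis , lost , FA = T , (λ v → S₀⊑S v ∘ T⊑S₀ v) , F ,
          ≤-trans (half-low M deg) (*-monoʳ-≤ 2 (≤-trans lost (+-monoˡ-≤ (k * size T) (+-monoʳ-≤ (size T)
            (Absorb.bounded G c k₁ T A M (4 * k * size T) (λ R p x Ax → connM R p x (S₀⊑S x (A⊑S₀ x Ax)))
              degT FA stuck)))))
      where
      degT : ∑ₐ (λ e b → b2n (M e ∧ T (src e b))) ≤ 4 * k * size T
      degT = ≤-trans (≤-reflexive (degree-fibres M T)) (≤-trans (sum-mono term) (≤-reflexive (sum-*ˡ (4 * k) (b2n ∘ T))))
        where
        term : ∀ x → (if T x then degreeIn M x else 0) ≤ 4 * k * b2n (T x)
        term x with T x in eq
        ... | true  = ≤-trans (low⇒≤ M x (T⊑S₀ x eq)) (≤-reflexive (sym (*-identityʳ (4 * k))))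
        ... | false = z≤n
      stuck : ∀ x → A x ≡ true → ∃[ R ] (R c ≡ false × R x ≡ true × out (avoid T) R < k * amount (on T) R + k)
      stuck x Ax with feasible? (avoid (insert x T)) (k · on (insert x T))
      ... | inj₁ F⁺ = contra (mx {insert x T} (λ _ → ∨ˡ)
              ((λ v p → [ T⊑S₀ v , (λ q → subst (λ z → S₀ z ≡ true) (sym (==⇒≡ q)) (A⊑S₀ x Ax)) ]′ (∨⁻ {T v} p)) , F⁺) x (∨ʳ {T x} (==-refl x))) (dis x Ax)
      ... | inj₂ (R , p , l) = R , p , Rx , bound
        where
        l′ : out (avoid (insert x T)) R < k * (amount (on T) R + b2n (R x))
        l′ = subst (λ z → out (avoid (insert x T)) R < k * z) (on-insert x T (dis x Ax) R) l
        -- Without `x` the demand of `R` is that of `T` alone, which `FA` covers even though it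
        -- forbids transit through all of `A`.
        Rx : R x ≡ true
        Rx with R x in eq
        ... | true  = refl
        ... | false = ⊥-elim (<⇒≱ l′ (≤-trans (*-monoʳ-≤ k (≤-reflexive (trans (cong (λ z → amount (on T) R + b2n z) eq) (+-identityʳ _)))) (≤-trans (m≤m+n _ _) (≤-trans (FA R p)
              (avoid-mono {T ∪ᵇ A} {insert x T} (λ v q → [ ∨ˡ , (λ q → ∨ʳ {T v} (subst (λ z → A z ≡ true) (sym (==⇒≡ q)) Ax)) ]′ (∨⁻ {T v} q)) R)))))
        -- An arc leaving `R` cannot end in `x`, which lies in `R`, so forbidding entry to `x`
        -- changes no exit of `R`.
        bound : out (avoid T) R < k * amount (on T) R + k
        bound = ≤-<-trans (out-mono (avoid T) (avoid (insert x T)) R λ e b cr h →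
            cong not (∨-false (not⁻ h) (¬true λ q → contra Rx (trans (cong R (sym (==⇒≡ q))) (not⁻ (proj₂ (∧⁻ {R (src e b)} cr)))))))
          (<-≤-trans l′ (≤-reflexive (trans (cong (λ z → k * (amount (on T) R + b2n z)) Rx) (trans (*-distribˡ-+ k _ 1) (cong (k * amount (on T) R +_) (*-identityʳ k))))))

-- Comparison with the constant `d k`.

^-monoˡ : ∀ n {a b} → a ≤ b → a ^ n ≤ b ^ n
^-monoˡ zero    h = ≤-refl
^-monoˡ (suc n) h = *-mono-≤ h (^-monoˡ n h)

1≤^ : ∀ a n → 1 ≤ suc a ^ n
1≤^ a zero    = ≤-refl
1≤^ a (suc n) = *-mono-≤ {1} {suc a} (s≤s z≤n) (1≤^ a n)

-- The left side is what `select` loses per selected vertex, times the `k` units that one terminal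
-- can supply. It is compared with the factor `(2 * k + 1) ^ (k + 1)` of the power in `d k`.
d-bound : ∀ k → 3 ≤ k → k * (2 * (1 + k ^ k * (1 + k + 4 * k) + k)) ≤ d k
d-bound k@(suc k₁) k≥3 = begin
  k * (2 * (1 + p * (1 + k + 4 * k) + k))      ≡⟨ eq₁ k p ⟩
  2 * k * ((1 + k) + p * (1 + k + 4 * k))      ≤⟨ *-monoʳ-≤ (2 * k) (+-monoˡ-≤ _ (≤-trans (≤-reflexive (sym (*-identityˡ (1 + k)))) (*-monoˡ-≤ (1 + k) (1≤^ k₁ k)))) ⟩
  2 * k * (p * (1 + k) + p * (1 + k + 4 * k))  ≡⟨ eq₂ k p ⟩
  p * (k * (12 * k + 4))                       ≤⟨ *-monoʳ-≤ p (*-monoʳ-≤ k le) ⟩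
  -- The factor `12` is written as `3 * (3 + 1)` so that `k ≥ 3` bounds it by `k * (k + 1)`.
  p * (k * ((2 * k + 1) * (3 * (3 + 1))))      ≤⟨ *-monoʳ-≤ p (*-monoʳ-≤ k (*-monoʳ-≤ (2 * k + 1) (*-mono-≤ k≥3 (+-monoˡ-≤ 1 k≥3)))) ⟩
  p * (k * ((2 * k + 1) * (k * (k + 1))))      ≡⟨ eq₃ k p ⟩
  p * (2 * k + 1) * (k * (k * 1)) * (k + 1)    ≤⟨ *-monoˡ-≤ (k + 1) (*-monoˡ-≤ (k * (k * 1)) power) ⟩
  d k                                          ∎
  where
  open ≤-Reasoning
  p = k ^ k
  eq₁ : ∀ k p → k * (2 * (1 + p * (1 + k + 4 * k) + k)) ≡ 2 * k * ((1 + k) + p * (1 + k + 4 * k))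
  eq₁ k p = solve (k ∷ p ∷ [])
  eq₂ : ∀ k p → 2 * k * (p * (1 + k) + p * (1 + k + 4 * k)) ≡ p * (k * (12 * k + 4))
  eq₂ k p = solve (k ∷ p ∷ [])
  eq₃ : ∀ k p → p * (k * ((2 * k + 1) * (k * (k + 1)))) ≡ p * (2 * k + 1) * (k * (k * 1)) * (k + 1)
  eq₃ k p = solve (k ∷ p ∷ [])
  le : 12 * k + 4 ≤ (2 * k + 1) * (3 * (3 + 1))
  le = linear (12 * k + 8) z≤n (eq k)
    where
    eq : ∀ k → 12 * k + 4 + 0 + (12 * k + 8) ≡ (2 * k + 1) * 12 + 0
    eq k = solve (k ∷ [])
  exponent : ∀ k → 8 * k + 4 ≡ k + (1 + (7 * k + 3))
  exponent k = solve (k ∷ [])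
  power : p * (2 * k + 1) ≤ (2 * k + 1) ^ (8 * k + 4)
  power = begin
    p * (2 * k + 1)                                       ≤⟨ *-mono-≤ (^-monoˡ k {k} (≤-trans (m≤m+n k _) (m≤m+n (2 * k) 1)))
                                                              (≤-reflexive (sym (*-identityʳ (2 * k + 1)))) ⟩
    (2 * k + 1) ^ k * ((2 * k + 1) * 1)                   ≤⟨ *-monoʳ-≤ ((2 * k + 1) ^ k) (*-monoʳ-≤ (2 * k + 1) (1≤^ _ (7 * k + 3))) ⟩
    (2 * k + 1) ^ k * ((2 * k + 1) ^ (1 + (7 * k + 3)))   ≡⟨ ^-distribˡ-+-* (2 * k + 1) k (1 + (7 * k + 3)) ⟨
    (2 * k + 1) ^ (k + (1 + (7 * k + 3)))                 ≡⟨ cong ((2 * k + 1) ^_) (exponent k) ⟨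
    (2 * k + 1) ^ (8 * k + 4)                             ∎

-- Walks, paths and cycles.

open import Data.List.Relation.Unary.All using (All; []; _∷_)
open import Data.List.Relation.Unary.AllPairs using ([]; _∷_)

∈⟪⟫⁺ : ∀ {n} {P : Fin n → Set} (P? : ∀ i → Dec (P i)) {i} → P i → i ∈ ⟪ P? ⟫
∈⟪⟫⁺ P? {i} p = lookup⇒[]= i _ (trans (lookup∘tabulate (λ j → does (P? j)) i) (holds (P? i)))
  where
  holds : (q : Dec _) → does q ≡ true
  holds (yes _) = refl
  holds (no ¬p) = ⊥-elim (¬p p)

Joins-sym : ∀ {G : Graph} {e u v} → Joins G e u v → Joins G e v u
Joins-sym (inj₁ p) = inj₂ p
Joins-sym (inj₂ p) = inj₁ p

∉⇒All≢ : ∀ {A : Set} {x : A} {xs} → ¬ (x ∈ˡ xs) → All (x ≢_) xs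
∉⇒All≢ h = All.tabulate λ y∈ x≡y → h (subst (_∈ˡ _) (sym x≡y) y∈)

All≢⇒∉ : ∀ {A : Set} {x : A} {xs} → All (x ≢_) xs → ¬ (x ∈ˡ xs)
All≢⇒∉ h x∈ = All.lookup h x∈ refl

module _ {G : Graph} {H : Subgraph G} where

  end∈ : ∀ {u v} → Walk H u v → v ∈ vertices H
  end∈ (stop p)       = p
  end∈ (step _ _ _ W) = end∈ W

  -- `walkVertices` omits the final vertex, so `v ∷ walkVertices W` is the form in which all
  -- vertices of a walk are listed.
  start∈ : ∀ {u v} (W : Walk H u v) → u ∈ˡ v ∷ walkVertices W
  start∈ (stop _)       = here refl
  start∈ (step _ _ _ _) = there (here refl)

  reverseOnto : ∀ {u v w} → Walk H u v → Walk H u w → Walk H v w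
  reverseOnto (stop _)        A = A
  reverseOnto (step e e∈ j W) A = reverseOnto W (step e e∈ (Joins-sym {G} {e} j) A)

  reverseOnto-edges : ∀ {u v w} (W : Walk H u v) (A : Walk H u w) {e} →
    e ∈ˡ walkEdges (reverseOnto W A) → e ∈ˡ walkEdges W ⊎ e ∈ˡ walkEdges A
  reverseOnto-edges (stop _)       A h = inj₂ h
  reverseOnto-edges (step e _ _ W) A h with reverseOnto-edges W _ h
  ... | inj₁ p           = inj₁ (there p)
  ... | inj₂ (here refl) = inj₁ (here refl)
  ... | inj₂ (there p)   = inj₂ p

  start∈H : ∀ {u v} → Walk H u v → u ∈ vertices H
  start∈H W = end∈ (reverseOnto W (stop′ W))
    where
    stop′ : ∀ {u v} → Walk H u v → Walk H u u
    stop′ (stop p) = stop p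
    stop′ (step e e∈ (inj₁ refl) W) = stop (proj₁ (closed H e∈))
    stop′ (step e e∈ (inj₂ refl) W) = stop (proj₂ (closed H e∈))

  reverse : ∀ {u v} → Walk H u v → Walk H v u
  reverse W = reverseOnto W (stop (start∈H W))

  from : ∀ {u v x} (W : Walk H u v) → x ∈ˡ v ∷ walkVertices W → Walk H x v
  from W               (here refl)         = stop (end∈ W)
  from W@(step _ _ _ _) (there (here refl)) = W
  from (step _ _ _ W)  (there (there p))   = from W (there p)

  from-edges : ∀ {u v x} (W : Walk H u v) (p : x ∈ˡ v ∷ walkVertices W) {e} →
    e ∈ˡ walkEdges (from W p) → e ∈ˡ walkEdges W
  from-edges (stop _)       (here refl)         ()
  from-edges (step _ _ _ _) (here refl)         ()
  from-edges (step _ _ _ _) (there (here refl)) h = h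
  from-edges (step _ _ _ W) (there (there p))   h = there (from-edges W (there p) h)

  record Path {u v} (W : Walk H u v) (x : V G) : Set where
    field
      path         : Walk H x v
      uniqueV      : Unique (v ∷ walkVertices path)
      uniqueE      : Unique (walkEdges path)
      edges⊆       : ∀ {e} → e ∈ˡ walkEdges path → e ∈ˡ walkEdges W

  open Path

  cut-to : ∀ {u v x} (W : Walk H u v) → Unique (v ∷ walkVertices W) → Unique (walkEdges W) →
    x ∈ˡ v ∷ walkVertices W → Path W x
  cut-to W uV uE (here refl) = record
    { path = stop (end∈ W) ; uniqueV = [] ∷ [] ; uniqueE = [] ; edges⊆ = λ () }
  cut-to W@(step _ _ _ _) uV uE (there (here refl)) = record { path = W ; uniqueV = uV ; uniqueE = uE ; edges⊆ = λ p → p }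
  cut-to (step _ _ _ W) ((_ ∷ v≢) ∷ (_ ∷ uV)) (_ ∷ uE) (there (there p)) =
    let P = cut-to W (v≢ ∷ uV) uE (there p)
    in record { path = path P ; uniqueV = uniqueV P ; uniqueE = uniqueE P ; edges⊆ = there ∘ edges⊆ P }

  erase-loops : ∀ {u v} (W : Walk H u v) → Unique (walkEdges W) → Path W u
  erase-loops (stop p) _ = record { path = stop p ; uniqueV = [] ∷ [] ; uniqueE = [] ; edges⊆ = λ () }
  erase-loops {u} {v} (step e e∈ j W) (e≢ ∷ uE) with erase-loops W uE
  ... | P with DecMembership._∈?_ _≟ᶠ_ u (v ∷ walkVertices (path P))
  ...   | yes u∈ = let Q = cut-to (path P) (uniqueV P) (uniqueE P) u∈
                   in record { path = path Q ; uniqueV = uniqueV Q ; uniqueE = uniqueE Q ; edges⊆ = there ∘ edges⊆ P ∘ edges⊆ Q }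
  ...   | no u∉ = record
      { path = step e e∈ j (path P)
      ; uniqueV = swap (uniqueV P) u∉
      ; uniqueE = ∉⇒All≢ (All≢⇒∉ e≢ ∘ edges⊆ P) ∷ uniqueE P
      ; edges⊆ = λ { (here refl) → here refl ; (there p) → there (edges⊆ P p) } }
    where
    swap : ∀ {xs} → Unique (v ∷ xs) → ¬ (u ∈ˡ v ∷ xs) → Unique (v ∷ u ∷ xs)
    swap (v≢ ∷ uV) h = ((λ v≡u → h (here (sym v≡u))) ∷ v≢) ∷ (∉⇒All≢ (h ∘ there) ∷ uV)

  cycle : ∀ {u v} e → e ∈ edges H → Joins G e u v → (W : Walk H v u) → Unique (walkEdges W) →
    ¬ (e ∈ˡ walkEdges W) → HasCycleThrough H u
  cycle e e∈ j W uE e∉ = let P = erase-loops W uE in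
    step e e∈ j (path P) , s≤s z≤n , uniqueV P , (∉⇒All≢ (e∉ ∘ edges⊆ P) ∷ uniqueE P)

  reverseOnto-unique : ∀ {u v w} (W : Walk H u v) (A : Walk H u w) → Unique (walkEdges W) → Unique (walkEdges A) →
    Disjoint (walkEdges W) (walkEdges A) → Unique (walkEdges (reverseOnto W A))
  reverseOnto-unique (stop _)       A _         uA _ = uA
  reverseOnto-unique (step e _ _ W) A (e≢ ∷ uW) uA d = reverseOnto-unique W _ uW
    (∉⇒All≢ (λ p → d (here refl , p)) ∷ uA)
    λ { (p , here refl) → All≢⇒∉ e≢ p ; (p , there q) → d (there p , q) }

  reverse-edges : ∀ {u v} (W : Walk H u v) {e} → e ∈ˡ walkEdges (reverse W) → e ∈ˡ walkEdges W
  reverse-edges W h with reverseOnto-edges W _ h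
  ... | inj₁ p = p

  -- Made for loops of `F`, whose two halves start at the same vertex. The first edge of `W₁` does
  -- not recur, and the rest of `W₁` followed by `W₂` backwards leads back to `u`.
  cycle-of-two : ∀ {u c} → u ≢ c → (W₁ W₂ : Walk H u c) → Unique (walkEdges W₁) → Unique (walkEdges W₂) →
    Disjoint (walkEdges W₁) (walkEdges W₂) → HasCycleThrough H u
  cycle-of-two u≢c (stop _) _ _ _ _ = ⊥-elim (u≢c refl)
  cycle-of-two u≢c (step e e∈ j W) W₂ (e≢ ∷ u₁) u₂ d =
    cycle e e∈ j (reverseOnto (reverse W) (reverse W₂))
      (reverseOnto-unique (reverse W) (reverse W₂) (reverse-unique W u₁) (reverse-unique W₂ u₂)
        λ (p , q) → d (there (reverse-edges W p) , reverse-edges W₂ q))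
      λ p → [ All≢⇒∉ e≢ ∘ reverse-edges W , (λ q → d (here refl , reverse-edges W₂ q)) ]′
              (reverseOnto-edges (reverse W) (reverse W₂) p)
    where
    reverse-unique : ∀ {u v} (W : Walk H u v) → Unique (walkEdges W) → Unique (walkEdges (reverse W))
    reverse-unique W uW = reverseOnto-unique W _ uW [] λ { (_ , ()) }

  edge-ends : ∀ {u v} (W : Walk H u v) {e} → e ∈ˡ walkEdges W →
    end₁ G e ∈ˡ v ∷ walkVertices W × end₂ G e ∈ˡ v ∷ walkVertices W
  edge-ends (step e _ j W) p = go j p
    where
    later : ∀ {x y z} {xs : List (V G)} → x ∈ˡ y ∷ xs → x ∈ˡ y ∷ z ∷ xs
    later (here p)  = here p
    later (there p) = there (there p)
    go : ∀ {e₀ u x v} {W : Walk H x v} → Joins G e₀ u x → ∀ {e} → e ∈ˡ e₀ ∷ walkEdges W →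
      end₁ G e ∈ˡ v ∷ u ∷ walkVertices W × end₂ G e ∈ˡ v ∷ u ∷ walkVertices W
    go {W = W} (inj₁ refl) (here refl) = there (here refl) , later (start∈ W)
    go {W = W} (inj₂ refl) (here refl) = later (start∈ W) , there (here refl)
    go {W = W} _ (there p) = let a , b = edge-ends W p in later a , later b

  module _ {K : Subgraph G} where

    transfer : ∀ {u v} (W : Walk H u v) → (∀ {e} → e ∈ˡ walkEdges W → e ∈ edges K) → v ∈ vertices K → Walk K u v
    transfer (stop _)       h v∈ = stop v∈
    transfer (step e _ j W) h v∈ = step e (h (here refl)) j (transfer W (h ∘ there) v∈)

    transfer-edges : ∀ {u v} (W : Walk H u v) (h : ∀ {e} → e ∈ˡ walkEdges W → e ∈ edges K) (v∈ : v ∈ vertices K) →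
      walkEdges (transfer W h v∈) ≡ walkEdges W
    transfer-edges (stop _)       h v∈ = refl
    transfer-edges (step e _ _ W) h v∈ = cong (e ∷_) (transfer-edges W (h ∘ there) v∈)

whole : ∀ G → Subgraph G
whole G = record { vertices = tabulate (λ _ → true) ; edges = tabulate (λ _ → true)
                 ; closed = λ _ → ∈whole _ , ∈whole _ }
  where
  ∈whole : ∀ {n} (i : Fin n) → i ∈ tabulate (λ _ → true)
  ∈whole i = lookup⇒[]= i _ (lookup∘tabulate (λ _ → true) i)


-- Edge-disjoint walks to `c` from the cut condition.

module Routes (G : Graph) (c : V G) where

  open Release G c

  e∈whole : ∀ e → e ∈ edges (whole G)
  e∈whole e = lookup⇒[]= e _ (lookup∘tabulate (λ _ → true) e)

  c∈whole : c ∈ vertices (whole G)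
  c∈whole = lookup⇒[]= c _ (lookup∘tabulate (λ _ → true) c)

  Alive Dead : Arc → E G → Set
  Alive α e = ∃[ b ] α e b ≡ true
  Dead α e = ∀ b → α e b ≡ false

  Entered : Arc → V G → Set
  Entered α v = ∃[ e ] ∃[ b ] (α e b ≡ true × dst e b ≡ v)

  _≼_ : Arc → Arc → Set
  β ≼ α = ∀ e b → β e b ≡ true → α e b ≡ true

  dead-mono : ∀ {α β e} → β ≼ α → Dead α e → Dead β e
  dead-mono {e = e} h d b = ¬true λ p → contra (h e b p) (d b)

  alive-dead : ∀ {α e} → Alive α e → Dead α e → ⊥
  alive-dead (b , p) d = contra p (d b)

  joins : ∀ e b → Joins G e (src e b) (dst e b)
  joins e true  = inj₁ refl
  joins e false = inj₂ refl

  -- One walk is peeled off: `rest` still meets the demand `D` and has neither arc of an edge used,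
  -- so later walks are edge-disjoint from this one. `entered` is what keeps walks out of `T` when
  -- `α` has no arc into `T`.
  record Route (α : Arc) (D : Demand (#V G)) (u : V G) : Set where
    field
      walk     : Walk (whole G) u c
      rest     : Arc
      simple   : Single rest
      feasible : Feasible rest D
      smaller  : rest ≼ α
      alive    : ∀ {e} → e ∈ˡ walkEdges walk → Alive α e
      dead     : ∀ {e} → e ∈ˡ walkEdges walk → Dead rest e
      unique   : Unique (walkEdges walk)
      entered  : ∀ {v} → v ∈ˡ walkVertices walk → v ≡ u ⊎ Entered α v

  is-refl : ∀ e b → is e b e b ≡ true
  is-refl e true  = ∧⁺ (==-refl e) refl
  is-refl e false = ∧⁺ (==-refl e) refl

  killed : ∀ α e b → kill α e b e b ≡ false
  killed α e b = trans (cong (λ q → α e b ∧ not q) (is-refl e b)) (𝔹.∧-zeroʳ (α e b))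

  kill-dead : ∀ α e b → Single α → α e b ≡ true → Dead (kill α e b) e
  kill-dead α e b s αe b′ with b′ 𝔹.≟ b
  ... | yes refl = killed α e b
  ... | no b′≢b  = ¬true λ p → both b b′ b′≢b αe (kill⁻ α e b e b′ p)
    where
    both : ∀ b b′ → b′ ≢ b → α e b ≡ true → α e b′ ≡ true → ⊥
    both true  true  h _ _ = h refl
    both false false h _ _ = h refl
    both true  false _ p q = s e (p , q)
    both false true  _ p q = s e (q , p)

  extend : ∀ α D e b → Single α → α e b ≡ true → Route (kill α e b) D (dst e b) → Route α D (src e b)
  extend α D e b s αe r = record
    { walk     = step e (e∈whole e) (joins e b) R.walk
    ; rest     = R.rest
    ; simple   = R.simple
    ; feasible = R.feasible
    ; smaller  = λ e′ b′ p → kill⁻ α e b e′ b′ (R.smaller e′ b′ p)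
    ; alive    = λ { (here refl) → b , αe ; (there p) → later (R.alive p) }
    ; dead     = λ { (here refl) → dead-mono {kill α e b} {R.rest} R.smaller e-dead ; (there p) → R.dead p }
    ; unique   = ∉⇒All≢ (λ p → alive-dead {kill α e b} (R.alive p) e-dead) ∷ R.unique
    ; entered  = λ { (here refl) → inj₁ refl ; (there p) → inj₂ (reached (R.entered p)) } }
    where
    module R = Route r
    e-dead : Dead (kill α e b) e
    e-dead = kill-dead α e b s αe
    later : ∀ {e′} → Alive (kill α e b) e′ → Alive α e′
    later {e′} (b′ , p) = b′ , kill⁻ α e b e′ b′ p
    reached : ∀ {v} → v ≡ dst e b ⊎ Entered (kill α e b) v → Entered α v
    reached (inj₁ eq) = e , b , αe , sym eq
    reached (inj₂ (e′ , b′ , p , q)) = e′ , b′ , kill⁻ α e b e′ b′ p , q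

  count : Arc → ℕ
  count α = ∑ₐ (λ e b → b2n (α e b))

  count-kill : ∀ α e b → α e b ≡ true → count (kill α e b) < count α
  count-kill α e b αe = ∑ₐ-mono-< (λ e′ b′ → b2n-mono {kill α e b e′ b′} (kill⁻ α e b e′ b′)) e b
    (subst₂ (λ x y → b2n x < b2n y) (sym (killed α e b)) (sym αe) ≤-refl)

  route-within : ∀ m α D u → count α ≤ m → Single α → Feasible α (D ⊕ at u) → Route α D u
  route-within m α D u h s F with u ≟ᶠ c
  ... | yes refl = record
    { walk = stop c∈whole ; rest = α ; simple = s ; smaller = λ _ _ p → p
    ; feasible = λ R p → ≤-trans (m≤m+n _ _) (F R p)
    ; alive = λ () ; dead = λ () ; unique = [] ; entered = λ () }
  route-within zero α D u h s F | no u≢c =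
    let e , b , αe , _ = push α D u F u≢c in ⊥-elim (<⇒≱ (count-kill α e b αe) (≤-trans h z≤n))
  route-within (suc m) α D u h s F | no u≢c =
    let e , b , αe , src≡u , F′ = push α D u F u≢c in
    subst (Route α D) src≡u (extend α D e b s αe
      (route-within m (kill α e b) D (dst e b) (≤-pred (≤-trans (count-kill α e b αe) h))
        (λ e′ (p , q) → s e′ (kill⁻ α e b e′ true p , kill⁻ α e b e′ false q)) F′))

  route : ∀ α D u → Single α → Feasible α (D ⊕ at u) → Route α D u
  route α D u = route-within (count α) α D u ≤-refl

  -- The future image of an edge of `F`. The two halves are kept apart instead of being joined at
  -- `c`, since for a loop they provide the cycle.
  record Link (α : Arc) (u₁ u₂ : V G) : Set where
    field
      walk₁    : Walk (whole G) u₁ c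
      walk₂    : Walk (whole G) u₂ c
      unique₁  : Unique (walkEdges walk₁)
      unique₂  : Unique (walkEdges walk₂)
      disjoint : Disjoint (walkEdges walk₁) (walkEdges walk₂)
      alive    : ∀ {e} → e ∈ˡ walkEdges walk₁ ++ walkEdges walk₂ → Alive α e
      entered  : ∀ {v} → v ∈ˡ walkVertices walk₁ ++ walkVertices walk₂ → v ≡ u₁ ⊎ v ≡ u₂ ⊎ Entered α v

    linkEdges : List (E G)
    linkEdges = walkEdges walk₁ ++ walkEdges walk₂

    linkVertices : List (V G)
    linkVertices = c ∷ walkVertices walk₁ ++ walkVertices walk₂

  open Link using (linkEdges; linkVertices)

  weaken : ∀ {α β u₁ u₂} → β ≼ α → Link β u₁ u₂ → Link α u₁ u₂
  weaken h l = record
    { walk₁ = walk₁ ; walk₂ = walk₂ ; unique₁ = unique₁ ; unique₂ = unique₂ ; disjoint = disjoint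
    ; alive = λ p → let b , q = alive p in b , h _ b q
    ; entered = λ p → [ inj₁ , [ inj₂ ∘ inj₁ , (λ (e , b , q , d) → inj₂ (inj₂ (e , b , h e b q , d))) ]′ ]′ (entered p) }
    where open Link l

  links : ∀ m (s₁ s₂ : Fin m → V G) α → Single α → Feasible α (⨁ λ j → at (s₁ j) ⊕ at (s₂ j)) →
    Σ (∀ j → Link α (s₁ j) (s₂ j)) λ L → ∀ {i j} → i ≢ j → Disjoint (linkEdges (L i)) (linkEdges (L j))
  links zero    s₁ s₂ α s F = (λ ()) , λ { {()} }
  links (suc m) s₁ s₂ α s F = L , apart
    where
    D : Demand (#V G)
    D = ⨁ λ j → at (s₁ (suc j)) ⊕ at (s₂ (suc j))
    r₁ : Route α (D ⊕ at (s₂ zero)) (s₁ zero)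
    r₁ = route α (D ⊕ at (s₂ zero)) (s₁ zero) s λ R p →
      ≤-trans (≤-reflexive (eq (amount D R) (b2n (R (s₂ zero))) (b2n (R (s₁ zero))))) (F R p)
      where
      eq : ∀ a b c → a + b + c ≡ c + b + a
      eq a b c = trans (+-comm (a + b) c) (trans (cong (c +_) (+-comm a b)) (sym (+-assoc c b a)))
    module R₁ = Route r₁
    r₂ : Route R₁.rest D (s₂ zero)
    r₂ = route R₁.rest D (s₂ zero) R₁.simple R₁.feasible
    module R₂ = Route r₂
    tail : Σ (∀ j → Link R₂.rest (s₁ (suc j)) (s₂ (suc j))) λ L → ∀ {i j} → i ≢ j → Disjoint (linkEdges (L i)) (linkEdges (L j))
    tail = links m (s₁ ∘ suc) (s₂ ∘ suc) R₂.rest R₂.simple R₂.feasible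
    sub : R₂.rest ≼ α
    sub e b = R₁.smaller e b ∘ R₂.smaller e b
    head : Link α (s₁ zero) (s₂ zero)
    head = record
      { walk₁ = R₁.walk ; walk₂ = R₂.walk ; unique₁ = R₁.unique ; unique₂ = R₂.unique
      ; disjoint = λ (p , q) → alive-dead {R₁.rest} (R₂.alive q) (R₁.dead p)
      ; alive = λ p → [ R₁.alive , (λ q → let b , a = R₂.alive q in b , R₁.smaller _ b a) ]′ (∈-++⁻ (walkEdges R₁.walk) p)
      ; entered = λ p → [ (λ q → [ inj₁ , inj₂ ∘ inj₂ ]′ (R₁.entered q))
                        , (λ q → [ inj₂ ∘ inj₁ , (λ (e , b , a , d) → inj₂ (inj₂ (e , b , R₁.smaller e b a , d))) ]′ (R₂.entered q)) ]′
                        (∈-++⁻ (walkVertices R₁.walk) p) }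
    L : ∀ j → Link α (s₁ j) (s₂ j)
    L zero    = head
    L (suc j) = weaken sub (proj₁ tail j)
    head-dead : ∀ {e} → e ∈ˡ linkEdges head → Dead R₂.rest e
    head-dead p = [ (λ q → dead-mono {R₁.rest} {R₂.rest} R₂.smaller (R₁.dead q)) , R₂.dead ]′ (∈-++⁻ (walkEdges R₁.walk) p)
    tail-alive : ∀ j {e} → e ∈ˡ linkEdges (L (suc j)) → Alive R₂.rest e
    tail-alive j = Link.alive (proj₁ tail j)
    apart : ∀ {i j} → i ≢ j → Disjoint (linkEdges (L i)) (linkEdges (L j))
    apart {zero}  {zero}  h _ = h refl
    apart {zero}  {suc j} h (p , q) = alive-dead {R₂.rest} (tail-alive j q) (head-dead p)
    apart {suc i} {zero}  h (p , q) = alive-dead {R₂.rest} (tail-alive i p) (head-dead q)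
    apart {suc i} {suc j} h = proj₂ tail (h ∘ cong suc)

-- From `k` units per terminal to a strong immersion.

card-tabulate : ∀ {n} (f : Fin n → Bool) → ∣ tabulate f ∣ ≡ size f
card-tabulate {zero}  f = refl
card-tabulate {suc n} f with f zero
... | true  = cong suc (card-tabulate (f ∘ suc))
... | false = card-tabulate (f ∘ suc)

sum-fibres : ∀ {m n} (h : Fin m → Fin n) (r : Fin n → ℕ) →
  sum (λ f → r (h f)) ≡ sum (λ w → size (λ f → h f == w) * r w)
sum-fibres h r = trans (sum-cong-≗ λ f → sym (sum-δ r (h f)))
  (trans (∑-comm (λ f w → if w == h f then r w else 0)) (sum-cong-≗ λ w → trans (sum-cong-≗ λ f → lem (h f) w)
    (trans (sum-*ˡ (r w) (λ f → b2n (h f == w))) (*-comm (r w) _))))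
  where
  lem : ∀ v w → (if w == v then r w else 0) ≡ r w * b2n (v == w)
  lem v w with w ≟ᶠ v | v ≟ᶠ w
  ... | yes _    | yes _ = sym (*-identityʳ (r w))
  ... | no _     | no _  = sym (*-zeroʳ (r w))
  ... | yes refl | no ¬p = ⊥-elim (¬p refl)
  ... | no ¬p    | yes refl = ⊥-elim (¬p refl)

-- `sum≤` expresses injectivity into `T` in the form needed to compare demands, and is built up
-- together with `θ`.
record Embedding (n : ℕ) {m} (T : Sub m) : Set where
  field
    θ         : Fin n → Fin m
    injective : ∀ {i j} → θ i ≡ θ j → i ≡ j
    inside    : ∀ i → T (θ i) ≡ true
    sum≤      : ∀ r → sum (r ∘ θ) ≤ sum (λ v → b2n (T v) * r v)

embed : ∀ n {m} (T : Sub m) → n ≤ size T → Embedding n T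
embed zero    T _ = record { θ = λ () ; injective = λ { {()} } ; inside = λ () ; sum≤ = λ _ → z≤n }
embed (suc n) {m} T h = record { θ = θ′ ; injective = inj ; inside = ins
  ; sum≤ = λ r → ≤-trans (+-monoʳ-≤ (r t) (sum≤ r)) (≤-reflexive (trans (+-comm (r t) _) (sym (trans
      (sum-cong-≗ λ v → cong (_* r v) (bump-remove {A = T} t Tt v)) (sum-bump t (b2n ∘ remove t T) r))))) }
  where
  w : ∃[ t ] 0 < b2n (T t)
  w = sum-<-witness {f = λ _ → 0} (subst (_< size T) (sym (sum-zero m)) (≤-trans (s≤s z≤n) h))
  t : Fin m
  t = proj₁ w
  Tt : T t ≡ true
  Tt = positive (T t) (proj₂ w)
    where
    positive : ∀ b → 0 < b2n b → b ≡ true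
    positive true _ = refl
  open Embedding (embed n (remove t T) (+-cancelʳ-≤ 1 n _ (≤-trans (≤-reflexive (+-comm n 1)) (≤-trans h (≤-reflexive (size-remove T t Tt))))))
  θ′ : Fin (suc n) → Fin m
  θ′ zero    = t
  θ′ (suc i) = θ i
  new : ∀ i → t ≢ θ i
  new i eq = contra (proj₂ (∧⁻ {T (θ i)} (inside i))) (cong not (subst (λ v → (v == t) ≡ true) eq (==-refl t)))
  inj : ∀ {i j} → θ′ i ≡ θ′ j → i ≡ j
  inj {zero}  {zero}  _  = refl
  inj {zero}  {suc j} eq = ⊥-elim (new j eq)
  inj {suc i} {zero}  eq = ⊥-elim (new i (sym eq))
  inj {suc i} {suc j} eq = cong suc (injective eq)
  ins : ∀ i → T (θ′ i) ≡ true
  ins zero    = Tt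
  ins (suc i) = proj₁ (∧⁻ {T (θ i)} (inside i))

module Immerse (k : ℕ) (G F : Graph) (c : V G) (T : Sub (#V G)) (c∉T : T c ≡ false)
               (deg≤ : MaxDegree≤ F k) (emb : Embedding (#V F) T) where

  open Routes G c
  open Release G c
  open Embedding emb

  starts : Demand (#V G)
  starts = ⨁ λ f → at (θ (end₁ F f)) ⊕ at (θ (end₂ F f))

  -- Each vertex of `F` is the start of as many walks as its degree, at most `k`; a loop starts two
  -- walks there, just as it counts twice in `degree`.
  starts≤ : ∀ R → amount starts R ≤ k * amount (on T) R
  starts≤ R = begin
    amount starts R
      ≡⟨ ⨁-amount (λ f → at (θ (end₁ F f)) ⊕ at (θ (end₂ F f))) R ⟩
    sum (λ f → r (end₁ F f) + r (end₂ F f))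
      ≡⟨ ∑-distrib-+ (r ∘ end₁ F) (r ∘ end₂ F) ⟩
    sum (r ∘ end₁ F) + sum (r ∘ end₂ F)
      ≡⟨ cong₂ _+_ (sum-fibres (end₁ F) r) (sum-fibres (end₂ F) r) ⟩
    sum (λ w → n₁ w * r w) + sum (λ w → n₂ w * r w)
      ≡⟨ ∑-distrib-+ (λ w → n₁ w * r w) (λ w → n₂ w * r w) ⟨
    sum (λ w → n₁ w * r w + n₂ w * r w)
      ≤⟨ sum-mono (λ w → ≤-trans (≤-reflexive (sym (*-distribʳ-+ (r w) (n₁ w) (n₂ w)))) (*-monoˡ-≤ (r w) (few w))) ⟩
    sum (λ w → k * r w)
      ≡⟨ sum-*ˡ k r ⟩
    k * sum r
      ≤⟨ *-monoʳ-≤ k (sum≤ (b2n ∘ R)) ⟩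
    k * amount (on T) R ∎
    where
    open ≤-Reasoning
    r : V F → ℕ
    r w = b2n (R (θ w))
    n₁ n₂ : V F → ℕ
    n₁ w = size (λ f → end₁ F f == w)
    n₂ w = size (λ f → end₂ F f == w)
    few : ∀ w → n₁ w + n₂ w ≤ k
    few w = ≤-trans (≤-reflexive (sym (cong₂ _+_ (card-tabulate (λ f → end₁ F f == w)) (card-tabulate (λ f → end₂ F f == w))))) (deg≤ w)

  module _ (α : Arc) (α≼ : α ≼ avoid T)
           (L : ∀ f → Link α (θ (end₁ F f)) (θ (end₂ F f)))
           (apart : ∀ {f f′} → f ≢ f′ → Disjoint (Link.linkEdges (L f)) (Link.linkEdges (L f′))) where

    module _ (f : E F) where

      open Link (L f)

      vertex? : ∀ v → Dec (v ∈ˡ linkVertices)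
      vertex? v = DecMembership._∈?_ _≟ᶠ_ v linkVertices

      edge? : ∀ e → Dec (e ∈ˡ linkEdges)
      edge? e = DecMembership._∈?_ _≟ᶠ_ e linkEdges

      on₁ : ∀ {v} → v ∈ˡ c ∷ walkVertices walk₁ → v ∈ˡ linkVertices
      on₁ (here p)  = here p
      on₁ (there p) = there (∈-++⁺ˡ p)

      on₂ : ∀ {v} → v ∈ˡ c ∷ walkVertices walk₂ → v ∈ˡ linkVertices
      on₂ (here p)  = here p
      on₂ (there p) = there (∈-++⁺ʳ (walkVertices walk₁) p)

      ends∈ : ∀ {e} → e ∈ˡ linkEdges → end₁ G e ∈ˡ linkVertices × end₂ G e ∈ˡ linkVertices
      ends∈ p with ∈-++⁻ (walkEdges walk₁) p
      ... | inj₁ q = let a , b = edge-ends walk₁ q in on₁ a , on₁ b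
      ... | inj₂ q = let a , b = edge-ends walk₂ q in on₂ a , on₂ b

      image : Subgraph G
      image = record
        { vertices = ⟪ vertex? ⟫ ; edges = ⟪ edge? ⟫
        ; closed = λ p → let a , b = ends∈ (∈⟪⟫⁻ edge? p) in ∈⟪⟫⁺ vertex? a , ∈⟪⟫⁺ vertex? b }

      c∈ : c ∈ vertices image
      c∈ = ∈⟪⟫⁺ vertex? (here refl)

      branch₁ : Walk image (θ (end₁ F f)) c
      branch₁ = transfer walk₁ (λ p → ∈⟪⟫⁺ edge? (∈-++⁺ˡ p)) c∈

      branch₂ : Walk image (θ (end₂ F f)) c
      branch₂ = transfer walk₂ (λ p → ∈⟪⟫⁺ edge? (∈-++⁺ʳ (walkEdges walk₁) p)) c∈

      to-centre : ∀ {v} → v ∈ vertices image → Walk image v c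
      to-centre v∈ with ∈⟪⟫⁻ vertex? v∈
      ... | here refl = stop c∈
      ... | there p with ∈-++⁻ (walkVertices walk₁) p
      ...   | inj₁ q = transfer (from walk₁ (there q)) (λ r → ∈⟪⟫⁺ edge? (∈-++⁺ˡ (from-edges walk₁ (there q) r))) c∈
      ...   | inj₂ q = transfer (from walk₂ (there q)) (λ r → ∈⟪⟫⁺ edge? (∈-++⁺ʳ (walkEdges walk₁) (from-edges walk₂ (there q) r))) c∈

      image-connected : Connected image
      image-connected = (c , c∈) , λ u∈ v∈ → reverseOnto (reverse (to-centre u∈)) (reverse (to-centre v∈))

      image-incident : ∀ {v} → Incident F f v → θ v ∈ vertices image
      image-incident (inj₁ refl) = ∈⟪⟫⁺ vertex? (on₁ (start∈ walk₁))
      image-incident (inj₂ refl) = ∈⟪⟫⁺ vertex? (on₂ (start∈ walk₂))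

      θ≢c : ∀ {v} → θ v ≢ c
      θ≢c {v} eq = contra (inside v) (trans (cong T eq) c∉T)

      image-loop : ∀ {v} → Incident F f v → IsLoop F f → HasCycleThrough image (θ v)
      image-loop {v} inc lp = subst (λ w → HasCycleThrough image (θ w)) (at-end inc)
        (cycle-of-two θ≢c branch₁ (subst (λ w → Walk image (θ w) c) (sym lp) branch₂)
          (subst Unique (sym (transfer-edges walk₁ _ c∈)) unique₁)
          (subst Unique (sym (edges₂ lp)) unique₂)
          (λ (p , q) → disjoint (subst (_ ∈ˡ_) (transfer-edges walk₁ _ c∈) p , subst (_ ∈ˡ_) (edges₂ lp) q)))
        where
        at-end : Incident F f v → end₁ F f ≡ v
        at-end (inj₁ p) = p
        at-end (inj₂ p) = trans lp p
        edges₂ : ∀ {x} (eq : x ≡ end₂ F f) → walkEdges (subst (λ w → Walk image (θ w) c) (sym eq) branch₂) ≡ walkEdges walk₂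
        edges₂ refl = transfer-edges walk₂ _ c∈

      -- A vertex of the image is `c`, or one of the two starts, or is entered by an arc of
      -- `avoid T`; only the starts can lie in `T`.
      image-strong : ∀ {v} → ¬ Incident F f v → θ v ∉ vertices image
      image-strong {v} ¬inc v∈ with ∈⟪⟫⁻ vertex? v∈
      ... | here p = θ≢c p
      ... | there p with entered p
      ...   | inj₁ q                           = ¬inc (inj₁ (sym (injective q)))
      ...   | inj₂ (inj₁ q)                    = ¬inc (inj₂ (sym (injective q)))
      ...   | inj₂ (inj₂ (e , b , αe , d≡))    = contra (trans (cong T d≡) (inside v)) (not⁻ (α≼ e b αe))

    immersion : StrongImmersion F G
    immersion = record
      { immersion = record
        { θV = θ ; θE = image ; injective = injective ; connected = image-connected
        ; edge-disjoint = λ {f} {f′} f≢ (e , p) → let p₁ , p₂ = x∈p∩q⁻ _ _ p in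
            apart f≢ (∈⟪⟫⁻ (edge? f) p₁ , ∈⟪⟫⁻ (edge? f′) p₂)
        ; incident = λ {f} → image-incident f
        ; loop = λ {f} → image-loop f }
      ; strong = λ {f} → image-strong f }

  immerse : Feasible (avoid T) (k · on T) → StrongImmersion F G
  immerse feas =
    let α , feas′ , s , sub = single (avoid T) starts (λ R p → ≤-trans (starts≤ R) (feas R p))
        L , apart = links (#E F) (θ ∘ end₁ F) (θ ∘ end₂ F) α s feas′
    in immersion α sub L apart

-- A maximal demand on `X` and the separation it yields.

module Supply (k : ℕ) (G : Graph) (c : V G) (X : Sub (#V G)) where

  open Release G c
  open Select using (feasible-dec)

  -- Every vertex of X sends at most k units, without transit through X; a vertex
  -- sending fewer lies in the set side, all of whose exits are saturated.
  record Saturated : Set where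
    field
      b         : V G → ℕ
      bound     : ∀ v → b v ≤ k * b2n (X v)
      feasible  : Feasible (avoid X) (weight b)
      side      : Sub (#V G)
      tight     : Tight (avoid X) (weight b) side
      saturated : ∀ x → X x ≡ true → side x ≡ false → k ≤ b x

  private
    total≤ : ∀ b → (∀ v → b v ≤ k * b2n (X v)) → sum b ≤ k * size X
    total≤ b h = ≤-trans (sum-mono h) (≤-reflexive (sum-*ˡ k (b2n ∘ X)))

    bump-bound : ∀ b x → (∀ v → b v ≤ k * b2n (X v)) → X x ≡ true → b x < k → ∀ v → bump x b v ≤ k * b2n (X v)
    bump-bound b x h Xx l v with v ≟ᶠ x
    ... | yes refl = ≤-trans (≤-reflexive (+-comm (b v) 1)) (≤-trans l
                       (≤-reflexive (trans (sym (*-identityʳ k)) (cong (λ z → k * b2n z) (sym Xx)))))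
    ... | no _     = ≤-trans (≤-reflexive (+-identityʳ (b v))) (h v)

    Raisable : (V G → ℕ) → V G → Set
    Raisable b x = X x ≡ true × b x < k × Feasible (avoid X) (weight b ⊕ at x)

    raisable? : ∀ b x → Dec (Raisable b x)
    raisable? b x = (X x 𝔹.≟ true) ×-dec (b x <? k) ×-dec feasible-dec G c 0 X (avoid X) (weight b ⊕ at x)

    -- `side` is a maximal tight set. If `x` sends fewer than `k` units and cannot be raised, the
    -- violated set contains `x` and is tight for the present demand, so `side` absorbs it.
    stop-raising : ∀ b → (∀ v → b v ≤ k * b2n (X v)) → Feasible (avoid X) (weight b) → ¬ ∃ (Raisable b) → Saturated
    stop-raising b h F ¬r = record { b = b ; bound = h ; feasible = F ; side = R ; tight = tR ; saturated = sat }
      where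
      spec : ∃[ R ] (∅ᵇ ⊑ R × Maximal (Tight (avoid X) (weight b)) R)
      spec = maximal (tight? (avoid X) (weight b)) (λ {A} {B} → tight-ext (avoid X) (weight b) {A} {B})
        ∅ᵇ (refl , ≤-trans (≤-reflexive (out-∅ (avoid X))) z≤n)
      R : Sub (#V G)
      R = proj₁ spec
      tR : Tight (avoid X) (weight b) R
      tR = proj₁ (proj₂ (proj₂ spec))
      absorbed : ∀ x R′ → R′ c ≡ false → out (avoid X) R′ < amount (weight b) R′ + b2n (R′ x) → R x ≡ true
      absorbed x R′ p l = proj₂ (proj₂ (proj₂ spec)) {R ∪ᵇ R′} (λ _ → ∨ˡ)
          (proj₁ (tight-∪∩ (avoid X) (weight b) R R′ F tR (p , proj₁ inner))) x (∨ʳ {R x} (proj₂ inner))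
        where
        inner : out (avoid X) R′ ≤ amount (weight b) R′ × R′ x ≡ true
        inner with R′ x
        ... | true  = ≤-pred (≤-trans l (≤-reflexive (+-comm _ 1))) , refl
        ... | false = ⊥-elim (<⇒≱ l (≤-trans (≤-reflexive (+-identityʳ _)) (F R′ p)))
      sat : ∀ x → X x ≡ true → R x ≡ false → k ≤ b x
      sat x Xx Rx with b x <? k
      ... | no ¬l = ≮⇒≥ ¬l
      ... | yes l with feasible? (avoid X) (weight b ⊕ at x)
      ...   | inj₁ F⁺ = ⊥-elim (¬r (x , Xx , l , F⁺))
      ...   | inj₂ (R′ , p , v) = contra (absorbed x R′ p v) Rx

    raise-within : ∀ m b → (∀ v → b v ≤ k * b2n (X v)) → Feasible (avoid X) (weight b) → k * size X ≤ m + sum b → Saturated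
    raise-within m b h F le with any? (raisable? b)
    ... | no ¬r = stop-raising b h F ¬r
    raise-within zero b h F le | yes (x , Xx , l , _) = ⊥-elim (<⇒≱ (≤-trans (≤-reflexive
      (trans (+-comm 1 _) (sym (total-bump x b)))) (total≤ (bump x b) (bump-bound b x h Xx l))) le)
    raise-within (suc m) b h F le | yes (x , Xx , l , F⁺) = raise-within m (bump x b) (bump-bound b x h Xx l)
      (λ R p → ≤-trans (≤-reflexive (sum-bump x b (b2n ∘ R))) (F⁺ R p))
      (≤-trans le (≤-reflexive (trans (sym (+-suc m (sum b))) (cong (m +_) (trans (+-comm 1 (sum b)) (sym (total-bump x b)))))))

  saturate : Saturated
  saturate = raise-within (k * size X) (λ _ → 0) (λ _ → z≤n) (λ R p → ≤-trans (≤-reflexive (sum-zero (#V G))) z≤n) (m≤m+n _ _)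

  module Separation (sat : Saturated) where

    open Saturated sat

    Y : Sub (#V G)
    Y v = X v ∧ not (side v)

    K : Sub (#E G)
    K e = (avoid X e true ∧ crosses side e true) ∨ (avoid X e false ∧ crosses side e false)

    -- The demand splits along `side`: vertices of `Y` are saturated and pay `k` each, while the
    -- exits of the tight set `side` are paid for by the units sent from within it.
    cost : k * size Y + size K ≤ sum b
    cost = begin
      k * size Y + size K                       ≤⟨ +-mono-≤ (≤-trans (≤-reflexive (sym (sum-*ˡ k (b2n ∘ Y)))) (sum-mono outer))
                                                            (≤-trans (≤-trans (sum-mono λ e → exits e) (≤-reflexive (sym (∑ₐ-def _)))) (proj₂ tight)) ⟩
      sum (λ v → b v * b2n (not (side v))) + sum (λ v → b v * b2n (side v))
                                                ≡⟨ ∑-distrib-+ (λ v → b v * b2n (not (side v))) _ ⟨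
      sum (λ v → b v * b2n (not (side v)) + b v * b2n (side v))
                                                ≡⟨ sum-cong-≗ (λ v → halves (b v) (side v)) ⟩
      sum b                                     ∎
      where
      open ≤-Reasoning
      exits : ∀ e → b2n (K e) ≤ b2n (avoid X e true ∧ crosses side e true) + b2n (avoid X e false ∧ crosses side e false)
      exits e = lem (avoid X e true ∧ crosses side e true) _
        where
        lem : ∀ x y → b2n (x ∨ y) ≤ b2n x + b2n y
        lem = toWitness {a? = all𝔹 λ x → all𝔹 λ y → _ ≤? _} _
      outer : ∀ v → k * b2n (Y v) ≤ b v * b2n (not (side v))
      outer v = lem (X v) (side v) (saturated v)
        where
        lem : ∀ x s → (x ≡ true → s ≡ false → k ≤ b v) → k * b2n (x ∧ not s) ≤ b v * b2n (not s)
        lem true  false h = *-monoˡ-≤ 1 (h refl refl)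
        lem true  true  h = ≤-trans (≤-reflexive (*-zeroʳ k)) z≤n
        lem false _     h = ≤-trans (≤-reflexive (*-zeroʳ k)) z≤n
      halves : ∀ n s → n * b2n (not s) + n * b2n s ≡ n
      halves n true  = trans (cong (_+ n * 1) (*-zeroʳ n)) (*-identityʳ n)
      halves n false = trans (cong (n * 1 +_) (*-zeroʳ n)) (trans (+-identityʳ _) (*-identityʳ n))

    ∈tab : ∀ {n} (A : Sub n) {i} → A i ≡ true → i ∈ tabulate A
    ∈tab A {i} p = lookup⇒[]= i _ (trans (lookup∘tabulate A i) p)

    tab∈ : ∀ {n} (A : Sub n) {i} → i ∈ tabulate A → A i ≡ true
    tab∈ A {i} p = trans (sym (lookup∘tabulate A i)) ([]=⇒lookup p)

    H : Subgraph G
    H = delete G (tabulate Y) (tabulate K)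

    spared : ∀ {v} → v ∈ vertices H → Y v ≡ false
    spared v∈ = ¬true λ p → x∈∁p⇒x∉p v∈ (∈tab Y p)

    kept : ∀ {e} → e ∈ edges H → K e ≡ false
    kept e∈ = ¬true λ p → x∈∁p⇒x∉p (edge∉ e∈) (∈tab K p)
      where
      edge∉ : ∀ {e} → e ∈ edges H → e ∈ ∁ (tabulate K)
      edge∉ {e} e∈ = proj₁ (∈⟪⟫⁻ (λ e → (e ∈? ∁ (tabulate K)) ×-dec ((end₁ G e ∈? ∁ (tabulate Y)) ×-dec (end₂ G e ∈? ∁ (tabulate Y)))) {e} e∈)

    -- A walk coming from `c` would traverse this arc backwards to enter `side`. As an exit of
    -- `side`, the arc either ends in `X`, hence in `Y`, or belongs to `K`.
    no-entry : ∀ e b → K e ≡ false → Y (dst e b) ≡ false → side (dst e b) ≡ false → side (src e b) ≡ false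
    no-entry e b Ke Yd sd = lem (side (src e b)) (side (dst e b)) (X (dst e b)) (arc b Ke) Yd sd
      where
      arc : ∀ b → K e ≡ false → avoid X e b ∧ crosses side e b ≡ false
      arc true  h = ¬true λ p → contra (∨ˡ p) h
      arc false h = ¬true λ p → contra (∨ʳ {avoid X e true ∧ crosses side e true} p) h
      lem : ∀ s d x → not x ∧ (s ∧ not d) ≡ false → x ∧ not d ≡ false → d ≡ false → s ≡ false
      lem false _ _ _ _ _ = refl
      lem true false true  _ () _
      lem true false false () _ _

    outside : ∀ {u v} → Walk H u v → side u ≡ false → side v ≡ false
    outside (stop _) h = h
    outside (step e e∈ (inj₁ refl) W) h = outside W (no-entry e false (kept e∈) (spared (proj₁ (closed H e∈))) h)
    outside (step e e∈ (inj₂ refl) W) h = outside W (no-entry e true (kept e∈) (spared (proj₂ (closed H e∈))) h)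

    separated : ∀ {x} → X x ≡ true → ¬ Component H c x
    separated {x} Xx W = contra (∧⁺ Xx (cong not (outside W (proj₁ tight)))) (spared (end∈ W))

-- Conclusion: a large supply forces the immersion.

enough : ∀ k n t s → 3 ≤ k → d k * n ≤ k * s →
  s ≤ 2 * (t + k ^ k * (t + k * t + 4 * k * t) + k * t) → n ≤ t
enough k n t s k≥3 h l = ≮⇒≥ λ t<n → <⇒≱ positive (+-cancelʳ-≤ (t * d k) (d k) 0 (begin
  suc t * d k                                                     ≤⟨ *-monoˡ-≤ (d k) t<n ⟩
  n * d k                                                         ≡⟨ *-comm n (d k) ⟩
  d k * n                                                         ≤⟨ h ⟩
  k * s                                                           ≤⟨ *-monoʳ-≤ k l ⟩
  k * (2 * (t + k ^ k * (t + k * t + 4 * k * t) + k * t))         ≡⟨ eq k (k ^ k) t ⟩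
  t * (k * (2 * (1 + k ^ k * (1 + k + 4 * k) + k)))               ≤⟨ *-monoʳ-≤ t (d-bound k k≥3) ⟩
  t * d k                                                         ∎))
  where
  open ≤-Reasoning
  eq : ∀ k p t → k * (2 * (t + p * (t + k * t + 4 * k * t) + k * t)) ≡ t * (k * (2 * (1 + p * (1 + k + 4 * k) + k)))
  eq = solve-∀
  positive : 0 < d k
  positive = ≤-trans (*-mono-≤ {1} {k} (≤-trans (s≤s z≤n) k≥3) (*-mono-≤ {1} {2} (s≤s z≤n) (s≤s z≤n))) (d-bound k k≥3)

module Rich (k₁ : ℕ) (G : Graph) (c : V G) (X : Subset (#V G)) (c∉X : lookup X c ≡ false)
  (conn : ¬ (∃[ A ] ∃[ x ] (x ∈ X × CutSeparates G A c x × ∣ δ G A ∣ < suc k₁))) where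

  open Release G c

  k : ℕ
  k = suc k₁

  open Supply k G c (lookup X) using (Saturated)

  module _ (sat : Saturated) where

    open Saturated sat

    -- The support of the saturated demand. Each vertex sends at most `k` units, so `S` has at least
    -- `sum b` divided by `k` elements.
    S : Sub (#V G)
    S v = does (1 ≤? b v)

    S-bound : ∀ v → b v ≤ k * b2n (S v)
    S-bound v = lem (1 ≤? b v) (≤-trans (bound v) (X≤ (lookup X v)))
      where
      X≤ : ∀ x → k * b2n x ≤ k
      X≤ true  = ≤-reflexive (*-identityʳ k)
      X≤ false = ≤-trans (≤-reflexive (*-zeroʳ k)) z≤n
      lem : ∀ {n} (p? : Dec (1 ≤ n)) → n ≤ k → n ≤ k * b2n (does p?)
      lem (yes _) h = ≤-trans h (≤-reflexive (sym (*-identityʳ k)))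
      lem (no ¬p) h = ≤-trans (≤-pred (≰⇒> ¬p)) z≤n

    S-below : ∀ v → b2n (S v) ≤ b v
    S-below v = b2n≤ (S v) (does⇒ (1 ≤? b v))

    S⊑X : S ⊑ lookup X
    S⊑X v p = positive (lookup X v) (≤-trans (does⇒ (1 ≤? b v) p) (bound v))
      where
      positive : ∀ x → 1 ≤ k * b2n x → x ≡ true
      positive true  _ = refl
      positive false h = ⊥-elim (<⇒≱ h (≤-reflexive (*-zeroʳ k)))

    many : sum b ≤ k * size S
    many = ≤-trans (sum-mono S-bound) (≤-reflexive (sum-*ˡ k (b2n ∘ S)))

    star : Feasible (avoid S) (on S)
    star R p = ≤-trans (sum-mono (λ v → *-monoˡ-≤ (b2n (R v)) (S-below v)))
      (≤-trans (feasible R p) (Select.avoid-mono G c 0 S {lookup X} {S} S⊑X R))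

    -- The cut hypothesis names the side containing `c`, so it is applied to the complement of `R`;
    -- an edge of that cut has an orientation leaving `R`.
    connects : Sparsify.Connects G c S k (λ _ → true)
    connects R c∉R x Sx Rx = ≮⇒≥ λ l → conn (tabulate (not ∘ R) , x , lookup⇒[]= x X (S⊑X x Sx) ,
        (lookup⇒[]= c _ (trans (look c) (cong not c∉R)) , λ x∈ → contra (trans (sym (look x)) ([]=⇒lookup x∈)) (cong not Rx)) ,
        ≤-<-trans (≤-trans (≤-reflexive (card-tabulate (λ e → lookup A (end₁ G e) xor lookup A (end₂ G e))))
          (≤-trans (sum-mono per-edge) (≤-reflexive (sym (∑ₐ-def (λ e b → b2n (true ∧ crosses R e b))))))) l)
      where
      A : Subset (#V G)
      A = tabulate (not ∘ R)
      look : ∀ v → lookup A v ≡ not (R v)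
      look = lookup∘tabulate (not ∘ R)
      lem : ∀ x y → b2n (not x xor not y) ≤ b2n (x ∧ not y) + b2n (y ∧ not x)
      lem = toWitness {a? = all𝔹 λ x → all𝔹 λ y → _ ≤? _} _
      per-edge : ∀ e → b2n (lookup A (end₁ G e) xor lookup A (end₂ G e)) ≤ b2n (true ∧ crosses R e true) + b2n (true ∧ crosses R e false)
      per-edge e = subst₂ (λ x y → b2n (x xor y) ≤ b2n (true ∧ crosses R e true) + b2n (true ∧ crosses R e false))
        (sym (look (end₁ G e))) (sym (look (end₂ G e))) (lem (R (end₁ G e)) (R (end₂ G e)))

    realise : 3 ≤ k → ∀ F → MaxDegree≤ F k → d k * #V F ≤ sum b → StrongImmersion F G
    realise k≥3 F deg≤ supply = conclude (Select.select G c k₁ S star connects)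
      where
      conclude : ∃[ T ] (T ⊑ S × Select.Full G c k₁ S T ×
        size S ≤ 2 * (size T + k ^ k * (size T + k * size T + 4 * k * size T) + k * size T)) → StrongImmersion F G
      conclude (T , T⊑S , full , large) with #V F ≤? size T
      ... | yes n≤ = Immerse.immerse k G F c T (¬true λ p → contra (S⊑X c (T⊑S c p)) c∉X) deg≤ (embed (#V F) T n≤) full
      ... | no ¬n≤ = ⊥-elim (¬n≤ (enough k (#V F) (size T) (size S) k≥3 (≤-trans supply many) large))

theorem5 : ∀ (k : ℕ) → 3 ≤ k →
    ∀ (G : Graph) (c : V G) (X : Subset (#V G)) → c ∉ X →
    ¬ (∃[ A ] ∃[ x ] (x ∈ X × CutSeparates G A c x × ∣ δ G A ∣ < k)) →
    ∀ (F : Graph) → MaxDegree≤ F k → ¬ StrongImmersion F G →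
    ∃[ Y ] ∃[ K ] (Y ⊆ X
    × k * ∣ Y ∣ + ∣ K ∣ < d k * #V F
    × (∀ {x} → x ∈ X → ¬ Component (delete G Y K) c x))
theorem5 (suc k₁) k≥3 G c X c∉X conn F deg≤ ¬imm =
  tabulate Y , tabulate K ,
  (λ {v} v∈ → lookup⇒[]= v X (proj₁ (∧⁻ (tab∈ Y v∈)))) ,
  ≤-<-trans (≤-trans (≤-reflexive (cong₂ (λ y e → suc k₁ * y + e) (card-tabulate Y) (card-tabulate K))) cost)
    -- If the budget did not exceed the supply `sum b`, which bounds the cost, then the supply would
    -- suffice for an immersion of `F`.
    (≰⇒> λ supply → ¬imm (Rich.realise k₁ G c X (¬true (c∉X ∘ lookup⇒[]= c X)) conn sat k≥3 F deg≤ supply)) ,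
  λ x∈ → separated ([]=⇒lookup x∈)
  where
  open Supply (suc k₁) G c (lookup X)
  sat = saturate
  open Separation sat
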